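{- Let $\Gamma$ be a graph with a vertex partition $\{C_1,\dots,C_5,D\}$, where the indices of the sets $C_i$ are read in $\mathbb{Z}/5\mathbb{Z}$, such that: (i) $|C_1|=\cdots=|C_5|=2$; write $C_i=\{v_{i1},v_{i2}\}$. (ii) For every vertex $v\in D$, the numbers of neighbours of $v$ in $C_1,\dots,C_5$ are all congruent modulo $2$. (iii) One of the following three cases holds (the same case for all $i\in\mathbb{Z}/5\mathbb{Z}$), where the listed sets are the edge sets of the induced subgraphs: (a) for all $i$: with $j=i+1$, $C_i\cup C_j$ has edge set $\emptyset$ or $\{v_{i1}v_{j1},v_{i1}v_{j2},v_{i2}v_{j1},v_{i2}v_{j2}\}$; and with $j=i+2$, $C_i\cup C_j$ has edge set $\{v_{i1}v_{j1},v_{i1}v_{j2}\}$ or $\{v_{i2}v_{j1},v_{i2}v_{j2}\}$. (b) for all $i$: with $j=i+1$, $C_i\cup C_j$ has edge set $\{v_{i1}v_{j1},v_{i2}v_{j2}\}$ or $\{v_{i1}v_{j2},v_{i2}v_{j1}\}$; and with $j=i+2$, $C_i\cup C_j$ has edge set $\{v_{i1}v_{j1},v_{i1}v_{j2}\}$ or $\{v_{i2}v_{j1},v_{i2}v_{j2}\}$. (c) for all $i$: with $j=i+1$, $C_i\cup C_j$ has edge set $\{v_{i1}v_{j1},v_{i1}v_{j2}\}$ or $\{v_{i2}v_{j1},v_{i2}v_{j2}\}$; and with $j=i+2$, $C_i\cup C_j$ has edge set $\{v_{i1}v_{j1},v_{i2}v_{j1}\}$ or $\{v_{i1}v_{j2},v_{i2}v_{j2}\}$.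 Let $\pi$ be the permutation of $C_1\cup\dots\cup C_5$ with $\pi(v_{ia})=v_{i-1,a}$. Construct $\Gamma'$ from $\Gamma$ on the same vertex set as follows, leaving all other adjacencies unchanged. For every $v\in D$ that has exactly one neighbour $w$ in each $C_i$, replace each such edge $\{v,w\}$ by $\{v,\pi(w)\}$. Moreover, according to the cases above, simultaneously for every $i\in\mathbb{Z}/5\mathbb{Z}$: (a) replace the induced subgraph on $C_i\cup C_{i+2}$ by the former induced subgraph on $C_i\cup C_{i+3}$; (b) replace the induced subgraph on $C_i\cup C_{i+1}$ by the former induced subgraph on $C_{i+1}\cup C_{i+2}$, and replace the induced subgraph on $C_i\cup C_{i+2}$ by the former induced subgraph on $C_i\cup C_{i+3}$; (c) replace the induced subgraph on $C_i\cup C_{i+1}$ by the former induced subgraph on $C_i\cup C_{i+2}$, and replace the induced subgraph on $C_i\cup C_{i+2}$ by the former induced subgraph on $C_{i+1}\cup C_{i+2}$. Then $\Gamma'$ is $\mathbb{R}$-cospectral with $\Gamma$.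
   Context: Graphs are finite, simple and loopless. Two graphs with adjacency matrices $A$ and $A'$ are $\mathbb{R}$-cospectral if $A+rJ$ and $A'+rJ$ have the same spectrum for every $r\in\mathbb{R}$, where $J$ is the all-ones matrix. "Replace the induced subgraph on $C_i\cup C_j$ by the former induced subgraph on $C_k\cup C_l$" means: in the new graph, $v_{ia}$ and $v_{jb}$ are adjacent if and only if $v_{ka}$ and $v_{lb}$ were adjacent in $\Gamma$ ($a,b\in\{1,2\}$); the sets $C_i$ themselves remain edgeless. -}

module Defs where

open import Algebra.Bundles using (CommutativeRing)
open import Algebra.Structures using (IsCommutativeRing)
open import Data.Bool using (Bool; true; false; if_then_else_)
open import Data.Fin using (Fin; zero; suc; toℕ; punchIn; _≟_)
open import Data.Fin.Properties using (all?)
open import Data.List using (List; []; _∷_)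
open import Data.List.Membership.Propositional using (_∈_)
open import Data.Maybe using (Maybe; just; nothing)
open import Data.Nat as ℕ using (ℕ; zero; suc)
import Data.Nat.Properties as ℕ
open import Data.Nat.DivMod using (_%_; _mod_)
open import Data.Product using (∃; _×_; _,_; proj₁; proj₂)
open import Data.Rational as ℚ using (ℚ; 0ℚ; 1ℚ; ½; ∣_∣)
import Data.Rational.Properties as ℚ
open import Data.Sum using (_⊎_)
open import Data.Vec.Functional using (Vector)
open import Function.Bundles using (_⇔_)
open import Level using (0ℓ; _⊔_)
open import Relation.Binary.Structures using (IsEquivalence)
open import Relation.Binary.PropositionalEquality
  using (_≡_; refl; sym; trans; cong; cong₂; subst; subst₂)
open import Relation.Nullary using (Dec; does)
open import Relation.Nullary.Decidable using (from-yes)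

-- The real numbers: rational Cauchy sequences, with equality meaning that
-- the difference tends to zero.

IsCauchy : (ℕ → ℚ) → Set
IsCauchy x = ∀ ε → 0ℚ ℚ.< ε →
  ∃ λ N → ∀ m n → N ℕ.≤ m → N ℕ.≤ n → ∣ x m ℚ.- x n ∣ ℚ.< ε

TendsToZero : (ℕ → ℚ) → Set
TendsToZero x = ∀ ε → 0ℚ ℚ.< ε → ∃ λ N → ∀ n → N ℕ.≤ n → ∣ x n ∣ ℚ.< ε

record ℝ : Set where
  constructor real
  field
    seq    : ℕ → ℚ
    cauchy : IsCauchy seq

open ℝ

infix 4 _≈ᴿ_
record _≈ᴿ_ (x y : ℝ) : Set where
  constructor mk≈
  field
    difference→0 : TendsToZero (λ n → seq x n ℚ.- seq y n)

private

  module ℚ-ring = CommutativeRing ℚ.+-*-commutativeRing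

  open import Algebra.Properties.CommutativeSemigroup
    ℚ-ring.+-commutativeSemigroup using (interchange)
  open import Algebra.Properties.Group ℚ-ring.+-group
    using (//-rightDividesˡ; ⁻¹-anti-homo-//)
  open import Algebra.Properties.Ring ℚ-ring.ring using (x[y-z]≈xy-xz)

  neg-difference : ∀ x y → ℚ.- (x ℚ.- y) ≡ ℚ.- x ℚ.- ℚ.- y
  neg-difference x y = ℚ.neg-distrib-+ x (ℚ.- y)

  telescope : ∀ x y z → (x ℚ.- y) ℚ.+ (y ℚ.- z) ≡ x ℚ.- z
  telescope x y z = trans (sym (ℚ.+-assoc (x ℚ.- y) y (ℚ.- z)))
    (cong (ℚ._- z) (//-rightDividesˡ y x))

  difference-+ : ∀ x y z w →
    (x ℚ.- y) ℚ.+ (z ℚ.- w) ≡ (x ℚ.+ z) ℚ.- (y ℚ.+ w)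
  difference-+ x y z w = trans (interchange x (ℚ.- y) z (ℚ.- w))
    (cong (x ℚ.+ z ℚ.+_) (sym (ℚ.neg-distrib-+ y w)))

  difference-* : ∀ x y z w →
    x ℚ.* (z ℚ.- w) ℚ.+ w ℚ.* (x ℚ.- y) ≡ x ℚ.* z ℚ.- y ℚ.* w
  difference-* x y z w = trans
    (cong₂ ℚ._+_ (x[y-z]≈xy-xz x z w)
      (trans (x[y-z]≈xy-xz w x y)
        (cong₂ ℚ._-_ (ℚ.*-comm w x) (ℚ.*-comm w y))))
    (telescope (x ℚ.* z) (x ℚ.* w) (y ℚ.* w))

  half>0 : ∀ {ε} → 0ℚ ℚ.< ε → 0ℚ ℚ.< ½ ℚ.* ε
  half>0 {ε} ε>0 =
    subst (ℚ._< ½ ℚ.* ε) (ℚ.*-zeroʳ ½) (ℚ.*-monoʳ-<-pos ½ ε>0)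

  halves : ∀ ε → ½ ℚ.* ε ℚ.+ ½ ℚ.* ε ≡ ε
  halves ε = trans (sym (ℚ.*-distribʳ-+ ε ½ ½)) (ℚ.*-identityˡ ε)

  ∣a+b∣< : ∀ {ε} a b → ∣ a ∣ ℚ.< ½ ℚ.* ε → ∣ b ∣ ℚ.< ½ ℚ.* ε → ∣ a ℚ.+ b ∣ ℚ.< ε
  ∣a+b∣< {ε} a b a< b< = ℚ.≤-<-trans (ℚ.∣p+q∣≤∣p∣+∣q∣ a b)
    (subst (∣ a ∣ ℚ.+ ∣ b ∣ ℚ.<_) (halves ε) (ℚ.+-mono-< a< b<))

  scale : ∀ B ε → 0ℚ ℚ.< B → 0ℚ ℚ.< ε →
    ∃ λ δ → 0ℚ ℚ.< δ × (∀ a b → ∣ a ∣ ℚ.< B → ∣ b ∣ ℚ.< δ → ∣ a ℚ.* b ∣ ℚ.< ε)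
  scale B ε B>0 ε>0 = δ , δ>0 , bound
    where
    instance
      B-pos : ℚ.Positive B
      B-pos = ℚ.positive B>0
      B-nonZero : ℚ.NonZero B
      B-nonZero = ℚ.pos⇒nonZero B
      1/B-pos : ℚ.Positive (ℚ.1/ B)
      1/B-pos = ℚ.1/pos⇒pos B
    δ : ℚ
    δ = ℚ.1/ B ℚ.* ε
    δ>0 : 0ℚ ℚ.< δ
    δ>0 = subst (ℚ._< δ) (ℚ.*-zeroʳ (ℚ.1/ B)) (ℚ.*-monoʳ-<-pos (ℚ.1/ B) ε>0)
    Bδ≡ε : B ℚ.* δ ≡ ε
    Bδ≡ε = trans (sym (ℚ.*-assoc B (ℚ.1/ B) ε))
             (trans (cong (ℚ._* ε) (ℚ.*-inverseʳ B)) (ℚ.*-identityˡ ε))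
    bound : ∀ a b → ∣ a ∣ ℚ.< B → ∣ b ∣ ℚ.< δ → ∣ a ℚ.* b ∣ ℚ.< ε
    bound a b a< b< = subst₂ ℚ._<_ (sym (ℚ.∣p*q∣≡∣p∣*∣q∣ a b)) Bδ≡ε
      (ℚ.≤-<-trans
        (ℚ.*-monoʳ-≤-nonNeg ∣ b ∣ {{ℚ.∣-∣-nonNeg b}} (ℚ.<⇒≤ a<))
        (ℚ.*-monoʳ-<-pos B b<))

  bounded : ∀ {x} → IsCauchy x →
    ∃ λ B → 0ℚ ℚ.< B × ∃ λ N → ∀ n → N ℕ.≤ n → ∣ x n ∣ ℚ.< B
  bounded {x} cx = 1ℚ ℚ.+ ∣ x N ∣ , B>0 , N , bound
    where
    0<1 : 0ℚ ℚ.< 1ℚ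
    0<1 = from-yes (0ℚ ℚ.<? 1ℚ)
    N = proj₁ (cx 1ℚ 0<1)
    B>0 : 0ℚ ℚ.< 1ℚ ℚ.+ ∣ x N ∣
    B>0 = ℚ.+-mono-<-≤ 0<1 (ℚ.0≤∣p∣ (x N))
    bound : ∀ n → N ℕ.≤ n → ∣ x n ∣ ℚ.< 1ℚ ℚ.+ ∣ x N ∣
    bound n N≤n = subst (λ z → ∣ z ∣ ℚ.< 1ℚ ℚ.+ ∣ x N ∣) (//-rightDividesˡ (x N) (x n))
      (ℚ.≤-<-trans (ℚ.∣p+q∣≤∣p∣+∣q∣ (x n ℚ.- x N) (x N))
        (ℚ.+-monoˡ-< ∣ x N ∣ (proj₂ (cx 1ℚ 0<1) n N N≤n ℕ.≤-refl)))

  ⊔ˡ : ∀ {a b n} → a ℕ.⊔ b ℕ.≤ n → a ℕ.≤ n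
  ⊔ˡ {a} {b} = ℕ.≤-trans (ℕ.m≤m⊔n a b)

  ⊔ʳ : ∀ {a b n} → a ℕ.⊔ b ℕ.≤ n → b ℕ.≤ n
  ⊔ʳ {a} {b} = ℕ.≤-trans (ℕ.m≤n⊔m a b)

  null-+ : ∀ {x y} → TendsToZero x → TendsToZero y →
    TendsToZero (λ n → x n ℚ.+ y n)
  null-+ {x} {y} nx ny ε ε>0
    with nx (½ ℚ.* ε) (half>0 ε>0) | ny (½ ℚ.* ε) (half>0 ε>0)
  ... | M , p | N , q = M ℕ.⊔ N , λ n h →
    ∣a+b∣< (x n) (y n) (p n (⊔ˡ {M} {N} h)) (q n (⊔ʳ {M} {N} h))

  null-neg : ∀ {x} → TendsToZero x → TendsToZero (λ n → ℚ.- x n)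
  null-neg {x} nx ε ε>0 with nx ε ε>0
  ... | N , p = N , λ n h → subst (ℚ._< ε) (sym (ℚ.∣-p∣≡∣p∣ (x n))) (p n h)

  null-* : ∀ {x y} → IsCauchy x → TendsToZero y →
    TendsToZero (λ n → x n ℚ.* y n)
  null-* {x} {y} cx ny ε ε>0 with bounded cx
  ... | B , B>0 , M , p with scale B ε B>0 ε>0
  ... | δ , δ>0 , s with ny δ δ>0
  ... | N , q = M ℕ.⊔ N , λ n h →
    s (x n) (y n) (p n (⊔ˡ {M} {N} h)) (q n (⊔ʳ {M} {N} h))

  null-≗ : ∀ {x y} → (∀ n → x n ≡ y n) → TendsToZero x → TendsToZero y
  null-≗ e nx ε ε>0 with nx ε ε>0
  ... | N , p = N , λ n h → subst (λ z → ∣ z ∣ ℚ.< ε) (e n) (p n h)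

  null-0 : TendsToZero (λ _ → 0ℚ)
  null-0 ε ε>0 = 0 , λ _ _ → ε>0

  cauchy-const : ∀ q → IsCauchy (λ _ → q)
  cauchy-const q ε ε>0 = 0 , λ _ _ _ _ →
    subst (λ z → ∣ z ∣ ℚ.< ε) (sym (ℚ.+-inverseʳ q)) ε>0

  cauchy-+ : ∀ {x y} → IsCauchy x → IsCauchy y → IsCauchy (λ n → x n ℚ.+ y n)
  cauchy-+ {x} {y} cx cy ε ε>0
    with cx (½ ℚ.* ε) (half>0 ε>0) | cy (½ ℚ.* ε) (half>0 ε>0)
  ... | M , p | N , q = M ℕ.⊔ N , λ m n h k →
    subst (λ z → ∣ z ∣ ℚ.< ε) (difference-+ (x m) (x n) (y m) (y n))
      (∣a+b∣< (x m ℚ.- x n) (y m ℚ.- y n)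
        (p m n (⊔ˡ {M} {N} h) (⊔ˡ {M} {N} k))
        (q m n (⊔ʳ {M} {N} h) (⊔ʳ {M} {N} k)))

  cauchy-neg : ∀ {x} → IsCauchy x → IsCauchy (λ n → ℚ.- x n)
  cauchy-neg {x} cx ε ε>0 with cx ε ε>0
  ... | N , p = N , λ m n h k → subst (ℚ._< ε)
    (trans (sym (ℚ.∣-p∣≡∣p∣ (x m ℚ.- x n))) (cong ∣_∣ (neg-difference (x m) (x n))))
    (p m n h k)

  cauchy-* : ∀ {x y} → IsCauchy x → IsCauchy y → IsCauchy (λ n → x n ℚ.* y n)
  cauchy-* {x} {y} cx cy ε ε>0 with bounded cx | bounded cy
  ... | B , B>0 , M₁ , p₁ | C , C>0 , M₂ , p₂
    with scale B (½ ℚ.* ε) B>0 (half>0 ε>0) | scale C (½ ℚ.* ε) C>0 (half>0 ε>0)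
  ... | δ₁ , δ₁>0 , s₁ | δ₂ , δ₂>0 , s₂ with cy δ₁ δ₁>0 | cx δ₂ δ₂>0
  ... | N₁ , q₁ | N₂ , q₂ = (M₁ ℕ.⊔ M₂) ℕ.⊔ (N₁ ℕ.⊔ N₂) , λ m n h k →
    let hM = ⊔ˡ {M₁ ℕ.⊔ M₂} {N₁ ℕ.⊔ N₂} h
        kM = ⊔ˡ {M₁ ℕ.⊔ M₂} {N₁ ℕ.⊔ N₂} k
        hN = ⊔ʳ {M₁ ℕ.⊔ M₂} {N₁ ℕ.⊔ N₂} h
        kN = ⊔ʳ {M₁ ℕ.⊔ M₂} {N₁ ℕ.⊔ N₂} k
    in subst (λ z → ∣ z ∣ ℚ.< ε) (difference-* (x m) (x n) (y m) (y n))
      (∣a+b∣< (x m ℚ.* (y m ℚ.- y n)) (y n ℚ.* (x m ℚ.- x n))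
        (s₁ (x m) (y m ℚ.- y n) (p₁ m (⊔ˡ {M₁} {M₂} hM))
          (q₁ m n (⊔ˡ {N₁} {N₂} hN) (⊔ˡ {N₁} {N₂} kN)))
        (s₂ (y n) (x m ℚ.- x n) (p₂ n (⊔ʳ {M₁} {M₂} kM))
          (q₂ m n (⊔ʳ {N₁} {N₂} hN) (⊔ʳ {N₁} {N₂} kN))))

infixl 6 _+ᴿ_
infixl 7 _*ᴿ_
infix  8 -ᴿ_

_+ᴿ_ _*ᴿ_ : ℝ → ℝ → ℝ
x +ᴿ y = real (λ n → seq x n ℚ.+ seq y n) (cauchy-+ {seq x} {seq y} (cauchy x) (cauchy y))
x *ᴿ y = real (λ n → seq x n ℚ.* seq y n) (cauchy-* {seq x} {seq y} (cauchy x) (cauchy y))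

-ᴿ_ : ℝ → ℝ
-ᴿ x = real (λ n → ℚ.- seq x n) (cauchy-neg {seq x} (cauchy x))

fromℚ : ℚ → ℝ
fromℚ q = real (λ _ → q) (cauchy-const q)

0ᴿ 1ᴿ : ℝ
0ᴿ = fromℚ 0ℚ
1ᴿ = fromℚ 1ℚ

≗⇒≈ᴿ : ∀ {x y} → (∀ n → seq x n ≡ seq y n) → x ≈ᴿ y
≗⇒≈ᴿ {x} {y} e = mk≈ (null-≗
  (λ n → sym (trans (cong (ℚ._- seq y n) (e n)) (ℚ.+-inverseʳ (seq y n))))
  null-0)

private

  ≈ᴿ-isEquivalence : IsEquivalence _≈ᴿ_
  ≈ᴿ-isEquivalence = record
    { refl  = ≗⇒≈ᴿ (λ _ → refl)
    ; sym   = λ {x} {y} (mk≈ p) → mk≈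
        (null-≗ (λ n → ⁻¹-anti-homo-// (seq x n) (seq y n)) (null-neg p))
    ; trans = λ {x} {y} {z} (mk≈ p) (mk≈ q) → mk≈
        (null-≗ (λ n → telescope (seq x n) (seq y n) (seq z n)) (null-+ p q))
    }

  +ᴿ-cong : ∀ {x y u v} → x ≈ᴿ y → u ≈ᴿ v → x +ᴿ u ≈ᴿ y +ᴿ v
  +ᴿ-cong {x} {y} {u} {v} (mk≈ p) (mk≈ q) = mk≈ (null-≗
    (λ n → difference-+ (seq x n) (seq y n) (seq u n) (seq v n))
    (null-+ p q))

  *ᴿ-cong : ∀ {x y u v} → x ≈ᴿ y → u ≈ᴿ v → x *ᴿ u ≈ᴿ y *ᴿ v
  *ᴿ-cong {x} {y} {u} {v} (mk≈ p) (mk≈ q) = mk≈ (null-≗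
    (λ n → difference-* (seq x n) (seq y n) (seq u n) (seq v n))
    (null-+ (null-* {seq x} (cauchy x) q) (null-* {seq v} (cauchy v) p)))

  -ᴿ-cong : ∀ {x y} → x ≈ᴿ y → -ᴿ x ≈ᴿ -ᴿ y
  -ᴿ-cong {x} {y} (mk≈ p) = mk≈
    (null-≗ (λ n → neg-difference (seq x n) (seq y n)) (null-neg p))

  ℝ-isCommutativeRing : IsCommutativeRing _≈ᴿ_ _+ᴿ_ _*ᴿ_ -ᴿ_ 0ᴿ 1ᴿ
  ℝ-isCommutativeRing = record
    { isRing = record
      { +-isAbelianGroup = record
        { isGroup = record
          { isMonoid = record
            { isSemigroup = record
              { isMagma = record
                { isEquivalence = ≈ᴿ-isEquivalence
                ; ∙-cong = +ᴿ-cong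
                }
              ; assoc = λ x y z →
                  ≗⇒≈ᴿ (λ n → ℚ.+-assoc (seq x n) (seq y n) (seq z n))
              }
            ; identity = (λ x → ≗⇒≈ᴿ (λ n → ℚ.+-identityˡ (seq x n)))
                       , (λ x → ≗⇒≈ᴿ (λ n → ℚ.+-identityʳ (seq x n)))
            }
          ; inverse = (λ x → ≗⇒≈ᴿ (λ n → ℚ.+-inverseˡ (seq x n)))
                    , (λ x → ≗⇒≈ᴿ (λ n → ℚ.+-inverseʳ (seq x n)))
          ; ⁻¹-cong = -ᴿ-cong
          }
        ; comm = λ x y → ≗⇒≈ᴿ (λ n → ℚ.+-comm (seq x n) (seq y n))
        }
      ; *-cong = *ᴿ-cong
      ; *-assoc = λ x y z →
          ≗⇒≈ᴿ (λ n → ℚ.*-assoc (seq x n) (seq y n) (seq z n))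
      ; *-identity = (λ x → ≗⇒≈ᴿ (λ n → ℚ.*-identityˡ (seq x n)))
                   , (λ x → ≗⇒≈ᴿ (λ n → ℚ.*-identityʳ (seq x n)))
      ; distrib =
          (λ x y z → ≗⇒≈ᴿ (λ n → ℚ.*-distribˡ-+ (seq x n) (seq y n) (seq z n)))
        , (λ x y z → ≗⇒≈ᴿ (λ n → ℚ.*-distribʳ-+ (seq x n) (seq y n) (seq z n)))
      }
    ; *-comm = λ x y → ≗⇒≈ᴿ (λ n → ℚ.*-comm (seq x n) (seq y n))
    }

ℝ-commutativeRing : CommutativeRing 0ℓ 0ℓ
ℝ-commutativeRing = record { isCommutativeRing = ℝ-isCommutativeRing }

module Matrices {c ℓ} (R : CommutativeRing c ℓ) where
  open CommutativeRing R using
    (Carrier; _≈_; _+_; _*_; _-_; -_; 0#; 1#; +-rawMonoid; *-rawMonoid; semiring)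
  open import Algebra.Definitions.RawMonoid +-rawMonoid public using (sum)
  open import Algebra.Definitions.RawMonoid *-rawMonoid public
    using () renaming (sum to product)
  open import Algebra.Properties.Semiring.Exp semiring using (_^_)

  Matrix : ℕ → Set c
  Matrix n = Fin n → Fin n → Carrier

  -- Laplace expansion along the first row.
  det : ∀ {n} → Matrix n → Carrier
  det {zero}  M = 1#
  det {suc n} M = sum λ j →
    (- 1#) ^ toℕ j * (M zero j * det (λ a b → M (suc a) (punchIn j b)))

  scalar : ∀ {n} → Carrier → Matrix n
  scalar x i j = if does (i ≟ j) then x else 0#

  charpoly : ∀ {n} → Matrix n → Carrier → Carrier
  charpoly M x = det λ i j → scalar x i j - M i j

  -- λs lists the eigenvalues of M with multiplicity: the characteristic
  -- polynomial of M is ∏ᵢ (x - λsᵢ).  Over an infinite field, such as the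
  -- reals, identity of polynomials and of polynomial functions agree.
  IsSpectrum : ∀ {n} → Matrix n → Vector Carrier n → Set _
  IsSpectrum M λs = ∀ x → charpoly M x ≈ product (λ i → x - λs i)

  -- Equality of multisets of eigenvalues, for matrices whose characteristic
  -- polynomial splits (over the reals: in particular symmetric ones).
  SameSpectrum : ∀ {n} → Matrix n → Matrix n → Set (c ⊔ ℓ)
  SameSpectrum M M′ = ∀ λs → IsSpectrum M λs ⇔ IsSpectrum M′ λs

record Graph (n : ℕ) : Set where
  field
    adj       : Fin n → Fin n → Bool
    symmetric : ∀ u w → adj u w ≡ adj w u
    loopless  : ∀ u → adj u u ≡ false

open Graph public

open Matrices ℝ-commutativeRing public

A[_]+_J : ∀ {n} → Graph n → ℝ → Matrix n
(A[ Γ ]+ r J) u w = (if adj Γ u w then 1ᴿ else 0ᴿ) +ᴿ r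

ℝ-Cospectral : ∀ {n} → Graph n → Graph n → Set
ℝ-Cospectral Γ Γ′ =
  ∀ (r : ℝ) → SameSpectrum (A[ Γ ]+ r J) (A[ Γ′ ]+ r J)

-- Indices in ℤ/5ℤ; C₁,…,C₅ are numbered by 0,…,4.
ℤ₅ : Set
ℤ₅ = Fin 5

infixl 6 _⊕_ _⊖_

_⊕_ : ℤ₅ → ℕ → ℤ₅
i ⊕ k = (toℕ i ℕ.+ k) mod 5

_⊖_ : ℤ₅ → ℤ₅ → ℤ₅
j ⊖ i = (toℕ j ℕ.+ (5 ℕ.∸ toℕ i)) mod 5

pattern #1 = zero
pattern #2 = suc zero

-- A vertex partition {C₁,…,C₅,D} with Cᵢ = {vᵢ₁,vᵢ₂}; D may be empty.
record Partition (n : ℕ) : Set where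
  field
    v        : ℤ₅ → Fin 2 → Fin n
    class    : Fin n → Maybe (ℤ₅ × Fin 2)   -- nothing: the vertex lies in D
    class-v  : ∀ i a → class (v i a) ≡ just (i , a)
    class⁻¹  : ∀ {u i a} → class u ≡ just (i , a) → u ≡ v i a

boolToℕ : Bool → ℕ
boolToℕ e = if e then 1 else 0

data Case : Set where
  caseA caseB caseC : Case

module _ {n} (Γ : Graph n) (P : Partition n) where
  open Partition P

  InD : Fin n → Set
  InD u = class u ≡ nothing

  neighboursIn : ℤ₅ → Fin n → ℕ
  neighboursIn i u = boolToℕ (adj Γ u (v i #1)) ℕ.+ boolToℕ (adj Γ u (v i #2))

  ParityCondition : Set
  ParityCondition = ∀ u → InD u → ∀ i j →
    neighboursIn i u % 2 ≡ neighboursIn j u % 2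

  -- The edge set of the subgraph induced on Cᵢ ∪ Cⱼ (i ≠ j) is
  -- { vᵢₐvⱼᵦ | (α , β) ∈ es }; in particular Cᵢ and Cⱼ are edgeless.
  EdgeSet : ℤ₅ → ℤ₅ → List (Fin 2 × Fin 2) → Set
  EdgeSet i j es =
      (∀ α β → adj Γ (v i α) (v j β) ≡ true ⇔ (α , β) ∈ es)
    × (∀ α β → adj Γ (v i α) (v i β) ≡ false)
    × (∀ α β → adj Γ (v j α) (v j β) ≡ false)

  CaseCondition : Case → Set
  CaseCondition caseA = ∀ i →
      (  EdgeSet i (i ⊕ 1) []
       ⊎ EdgeSet i (i ⊕ 1)
           ((#1 , #1) ∷ (#1 , #2) ∷ (#2 , #1) ∷ (#2 , #2) ∷ []))
    × (  EdgeSet i (i ⊕ 2) ((#1 , #1) ∷ (#1 , #2) ∷ [])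
       ⊎ EdgeSet i (i ⊕ 2) ((#2 , #1) ∷ (#2 , #2) ∷ []))
  CaseCondition caseB = ∀ i →
      (  EdgeSet i (i ⊕ 1) ((#1 , #1) ∷ (#2 , #2) ∷ [])
       ⊎ EdgeSet i (i ⊕ 1) ((#1 , #2) ∷ (#2 , #1) ∷ []))
    × (  EdgeSet i (i ⊕ 2) ((#1 , #1) ∷ (#1 , #2) ∷ [])
       ⊎ EdgeSet i (i ⊕ 2) ((#2 , #1) ∷ (#2 , #2) ∷ []))
  CaseCondition caseC = ∀ i →
      (  EdgeSet i (i ⊕ 1) ((#1 , #1) ∷ (#1 , #2) ∷ [])
       ⊎ EdgeSet i (i ⊕ 1) ((#2 , #1) ∷ (#2 , #2) ∷ []))
    × (  EdgeSet i (i ⊕ 2) ((#1 , #1) ∷ (#2 , #1) ∷ [])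
       ⊎ EdgeSet i (i ⊕ 2) ((#1 , #2) ∷ (#2 , #2) ∷ []))

  oneInEach? : ∀ u → Dec (∀ i → neighboursIn i u ≡ 1)
  oneInEach? u = all? λ i → neighboursIn i u ℕ.≟ 1

  -- New adjacency of u ∈ D and vᵢₐ; note π⁻¹(vᵢₐ) = v₍ᵢ₊₁₎ₐ.
  adjD : Fin n → ℤ₅ → Fin 2 → Bool
  adjD u i α = if does (oneInEach? u)
    then adj Γ u (v (i ⊕ 1) α)
    else adj Γ u (v i α)

  -- New adjacency of vᵢₐ and v₍ᵢ₊₁₎ᵦ, respectively of vᵢₐ and v₍ᵢ₊₂₎ᵦ.
  adj₁ adj₂ : Case → ℤ₅ → Fin 2 → Fin 2 → Bool
  adj₁ caseA i α β = adj Γ (v i α) (v (i ⊕ 1) β)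
  adj₁ caseB i α β = adj Γ (v (i ⊕ 1) α) (v (i ⊕ 2) β)
  adj₁ caseC i α β = adj Γ (v i α) (v (i ⊕ 2) β)
  adj₂ caseA i α β = adj Γ (v i α) (v (i ⊕ 3) β)
  adj₂ caseB i α β = adj Γ (v i α) (v (i ⊕ 3) β)
  adj₂ caseC i α β = adj Γ (v (i ⊕ 1) α) (v (i ⊕ 2) β)

  -- New adjacency of vᵢₐ and vⱼᵦ, where δ = j - i.
  adjC : Case → (δ : ℤ₅) → ℤ₅ → Fin 2 → ℤ₅ → Fin 2 → Bool
  adjC κ zero                         i α j β = adj Γ (v i α) (v j β)
  adjC κ (suc zero)                   i α j β = adj₁ κ i α β
  adjC κ (suc (suc zero))             i α j β = adj₂ κ i α β
  adjC κ (suc (suc (suc zero)))       i α j β = adj₂ κ j β α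
  adjC κ (suc (suc (suc (suc zero)))) i α j β = adj₁ κ j β α

  switchedAdj : Case → Fin n → Fin n → Bool
  switchedAdj κ u w with class u | class w
  ... | nothing      | nothing      = adj Γ u w
  ... | nothing      | just (j , β) = adjD u j β
  ... | just (i , α) | nothing      = adjD w i α
  ... | just (i , α) | just (j , β) = adjC κ (j ⊖ i) i α j β

  private
    ⊖-self : ∀ i → i ⊖ i ≡ zero
    ⊖-self = from-yes (all? λ i → i ⊖ i ≟ zero)

    ⊖-swap : ∀ i j → i ⊖ j ≡ zero ⊖ (j ⊖ i)
    ⊖-swap = from-yes (all? λ i → all? λ j → i ⊖ j ≟ zero ⊖ (j ⊖ i))

    adjC-swap : ∀ κ δ i α j β → adjC κ δ i α j β ≡ adjC κ (zero ⊖ δ) j β i α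
    adjC-swap κ zero                         i α j β = symmetric Γ (v i α) (v j β)
    adjC-swap κ (suc zero)                   i α j β = refl
    adjC-swap κ (suc (suc zero))             i α j β = refl
    adjC-swap κ (suc (suc (suc zero)))       i α j β = refl
    adjC-swap κ (suc (suc (suc (suc zero)))) i α j β = refl

    switched-symmetric : ∀ κ u w → switchedAdj κ u w ≡ switchedAdj κ w u
    switched-symmetric κ u w with class u | class w
    ... | nothing      | nothing      = symmetric Γ u w
    ... | nothing      | just (j , β) = refl
    ... | just (i , α) | nothing      = refl
    ... | just (i , α) | just (j , β) =
      trans (adjC-swap κ (j ⊖ i) i α j β)
        (cong (λ δ → adjC κ δ j β i α) (sym (⊖-swap i j)))

    switched-loopless : ∀ κ u → switchedAdj κ u u ≡ false
    switched-loopless κ u with class u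
    ... | nothing      = loopless Γ u
    ... | just (i , α) = trans (cong (λ δ → adjC κ δ i α i α) (⊖-self i))
                               (loopless Γ (v i α))

  switched : Case → Graph n
  switched κ = record
    { adj       = switchedAdj κ
    ; symmetric = switched-symmetric κ
    ; loopless  = switched-loopless κ
    }

{-# OPTIONS --safe #-}

-- On each ℝ^Cᵢ let E = J/2 and F = I - J/2 be the projections onto the constant
-- vectors and onto the vectors of sum zero.  The matrix Q that is the identity
-- on D and E ⊗ I + F ⊗ S on C₁ ∪ … ∪ C₅, S the cyclic shift of the indices, is
-- orthogonal and fixes the all-ones vector, hence commutes with J.  In each of
-- the three cases QᵀAQ is the adjacency matrix of Γ′, so Qᵀ(xI - A - rJ)Q =
-- xI - A′ - rJ, and the characteristic polynomials agree because det is
-- multiplicative.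

module Submission where

open import Defs hiding (Matrix; sum; product; det; scalar; charpoly; IsSpectrum; SameSpectrum)
open import Algebra.Bundles using (CommutativeRing)
open import Data.Bool using (Bool; true; false; if_then_else_; _∧_)
open import Data.Fin using (Fin; zero; suc; toℕ; punchIn; punchOut; opposite; _≟_)
open import Data.Fin.Patterns using (0F; 1F; 2F; 3F; 4F)
open import Data.Fin.Properties
  using (all?; suc-injective; punchIn-injective; punchIn-punchOut; punchInᵢ≢i)
open import Data.Maybe using (Maybe; just; nothing)
open import Data.Maybe.Properties using (just-injective)
open import Data.Nat as ℕ using (ℕ; zero; suc)
open import Data.Nat.DivMod using (_%_)
open import Data.Product using (∃; _×_; _,_; proj₁; proj₂)
open import Data.Product.Properties using (≡-dec; ,-injective)
open import Data.Rational as ℚ using (ℚ; 0ℚ; 1ℚ; ½)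
import Data.Rational.Properties as ℚ
open import Data.Sum using (_⊎_; inj₁; inj₂; [_,_])
open import Data.Vec.Functional using (Vector; tail; updateAt; removeAt)
open import Data.Vec.Functional.Properties using (updateAt-updates; updateAt-minimal)
open import Function using (_∘_; const; _⇔_; mk⇔; Equivalence)
open import Level using (_⊔_)
open import Relation.Binary.PropositionalEquality as ≡ using (_≡_; _≢_)
open import Relation.Nullary using (Dec; does; yes; no; ¬_; contradiction)
open import Relation.Nullary.Decidable using (from-yes; dec-true; dec-false; _×-dec_)

-- Determinants

-- Why conjugation yields a 0-1 matrix: the block of QᵀAQ at (i, j) is E A(i,j) E + E A(i,j+1) F + F
-- A(i+1,j) E + F A(i+1,j+1) F. Except for the empty and complete blocks of case (a), which lie
-- wholly in the part EBE, every admissible block B between two different sets is J/2 plus a matrix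
-- in exactly one of the parts EBF, FBE, FBF, and this part is the same for both alternatives. Hence
-- at most one of the last three terms survives. It completes the common J/2 to the block from which
-- it comes, and this is the block that the construction of Γ′ copies; the empty and complete blocks
-- stay where they are. Two obstacles shape the rest. The determinant is given only by its Laplace
-- expansion, so multiplicativity is derived from that, over any commutative ring. And equality of
-- Cauchy sequences cannot be decided by computation; but Q and the 0-1 matrices consist of constant
-- sequences, so identities between entries descend to `ℚ`, where those on the ten vertices are
-- finite checks.

data Adjacent : ∀ {n} → Fin n → Fin n → Set where
  zero : ∀ {n} → Adjacent {suc (suc n)} zero (suc zero)
  suc  : ∀ {n} {i k : Fin n} → Adjacent i k → Adjacent (suc i) (suc k)

-- Minors that omit a third line inherit a pair of equal neighbours. This is why alternation is
-- demanded for neighbours only.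
adjacent-punchIn : ∀ {n} {i k : Fin (suc n)} j → Adjacent i k → j ≢ i → j ≢ k →
  ∃ λ i′ → ∃ λ k′ → Adjacent i′ k′ × punchIn j i′ ≡ i × punchIn j k′ ≡ k
adjacent-punchIn zero          zero    j≢i j≢k = contradiction ≡.refl j≢i
adjacent-punchIn zero          (suc p) j≢i j≢k = _ , _ , p , ≡.refl , ≡.refl
adjacent-punchIn (suc zero)    zero    j≢i j≢k = contradiction ≡.refl j≢k
adjacent-punchIn {suc (suc n)} (suc (suc j)) zero    j≢i j≢k =
  zero , suc zero , zero , ≡.refl , ≡.refl
adjacent-punchIn {suc n} (suc j)       (suc p) j≢i j≢k
  with adjacent-punchIn j p (j≢i ∘ ≡.cong suc) (j≢k ∘ ≡.cong suc)
... | i′ , k′ , p′ , i≡ , k≡ =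
  suc i′ , suc k′ , suc p′ , ≡.cong suc i≡ , ≡.cong suc k≡

-- The enumerations that omit `i` and `k` differ in one slot, where each shows the line that the
-- other omits. If the two lines are equal, so are the two minors.
punchIn-adjacent : ∀ {n} {i k : Fin (suc n)} → Adjacent i k → ∀ b →
  punchIn i b ≡ punchIn k b ⊎ (punchIn i b ≡ k × punchIn k b ≡ i)
punchIn-adjacent zero    zero    = inj₂ (≡.refl , ≡.refl)
punchIn-adjacent zero    (suc b) = inj₁ ≡.refl
punchIn-adjacent (suc p) zero    = inj₁ ≡.refl
punchIn-adjacent (suc p) (suc b) with punchIn-adjacent p b
... | inj₁ eq        = inj₁ (≡.cong suc eq)
... | inj₂ (eq , eq′) = inj₂ (≡.cong suc eq , ≡.cong suc eq′)

module Determinant {c ℓ} (R : CommutativeRing c ℓ) where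
  open CommutativeRing R hiding (zero)
  open Matrices R
  open import Data.Vec.Functional using (_∷_)
  open import Algebra.Properties.Ring ring using (-0#≈0#; -1*x≈-x)
  open import Algebra.Properties.AbelianGroup +-abelianGroup using (inverseˡ-unique)
  open import Algebra.Properties.Semiring.Exp semiring using (_^_)
  open import Algebra.Properties.Semiring.Sum semiring
    using (sum-cong-≋; sum-replicate-zero; sum-remove; ∑-distrib-+; *-distribˡ-sum; *-distribʳ-sum)
  open import Algebra.Solver.Ring.NaturalCoefficients.Default commutativeSemiring
    using (solve; _:=_; _:+_; _:*_)
  open import Relation.Binary.Reasoning.Setoid setoid

  infixl 7 _·_
  _·_ : ∀ {n} → Matrix n → Matrix n → Matrix n
  (M · N) i j = sum λ k → M i k * N k j

  sum-zero : ∀ {n} {f : Vector Carrier n} → (∀ i → f i ≈ 0#) → sum f ≈ 0#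
  sum-zero {n} f≈0 = trans (sum-cong-≋ f≈0) (sum-replicate-zero n)

  sum-adjacent : ∀ {n} {f : Vector Carrier n} {i k} → Adjacent i k →
    f i + f k ≈ 0# → (∀ j → j ≢ i → j ≢ k → f j ≈ 0#) → sum f ≈ 0#
  sum-adjacent {f = f} zero fi+fk≈0 f≈0 = begin
    f zero + (f (suc zero) + sum (tail (tail f))) ≈⟨ +-assoc _ _ _ ⟨
    (f zero + f (suc zero)) + sum (tail (tail f)) ≈⟨ +-cong fi+fk≈0
      (sum-zero λ j → f≈0 (suc (suc j)) (λ ()) (λ ())) ⟩
    0# + 0#                                       ≈⟨ +-identityʳ 0# ⟩
    0#                                            ∎
  sum-adjacent (suc p) fi+fk≈0 f≈0 = trans
    (+-cong (f≈0 zero (λ ()) (λ ()))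
      (sum-adjacent p fi+fk≈0 λ j j≢i j≢k →
        f≈0 (suc j) (j≢i ∘ suc-injective) (j≢k ∘ suc-injective)))
    (+-identityʳ 0#)

  sum-scalar : ∀ {n} (f : Vector Carrier n) j → sum (λ k → f k * scalar 1# k j) ≈ f j
  sum-scalar f zero = trans
    (+-cong (*-identityʳ (f zero)) (sum-zero λ k → zeroʳ (f (suc k))))
    (+-identityʳ (f zero))
  sum-scalar f (suc j) = trans
    (+-cong (zeroʳ (f zero)) (sum-scalar (tail f) j))
    (+-identityˡ (f (suc j)))

  det-cong : ∀ {n} {M N : Matrix n} → (∀ i j → M i j ≈ N i j) → det M ≈ det N
  det-cong {zero}  M≈N = refl
  det-cong {suc n} M≈N = sum-cong-≋ λ j → *-congˡ {(- 1#) ^ toℕ j}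
    (*-cong (M≈N zero j) (det-cong λ a b → M≈N (suc a) (punchIn j b)))

  -- The number `n` of arguments is independent of the dimension `m`, so that fixing an argument
  -- gives a map of the same kind. `linear` joins additivity and homogeneity, and compares three
  -- families up to `≈` off row `i` instead of updating one family.
  record Alternating {n m} (D : (Fin n → Vector Carrier m) → Carrier) : Set (c ⊔ ℓ) where
    field
      cong     : ∀ {us vs} → (∀ i j → us i j ≈ vs i j) → D us ≈ D vs
      linear   : ∀ i x us vs ws → (∀ j → us i j ≈ x * vs i j + ws i j) →
                 (∀ k → k ≢ i → ∀ j → us k j ≈ vs k j × us k j ≈ ws k j) →
                 D us ≈ x * D vs + D ws
      adjacent : ∀ {i k} → Adjacent i k → ∀ us → (∀ j → us i j ≈ us k j) → D us ≈ 0#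

  open Alternating

  Kills : ∀ {n m} → ((Fin n → Vector Carrier m) → Carrier) → Vector Carrier m → Set (c ⊔ ℓ)
  Kills D z = ∀ us i → (∀ j → us i j ≈ z j) → D us ≈ 0#

  ∷-cong : ∀ {n m} {u v : Vector Carrier m} {us vs : Fin n → Vector Carrier m} →
    (∀ j → u j ≈ v j) → (∀ i j → us i j ≈ vs i j) → ∀ i j → (u ∷ us) i j ≈ (v ∷ vs) i j
  ∷-cong u≈v us≈vs zero    = u≈v
  ∷-cong u≈v us≈vs (suc i) = us≈vs i

  module _ {n m} {D : (Fin (suc n) → Vector Carrier m) → Carrier} (alt : Alternating D) where

    fix-first : ∀ u → Alternating λ us → D (u ∷ us)
    fix-first u .cong us≈vs = alt .cong (∷-cong (λ _ → refl) us≈vs)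
    fix-first u .linear i x us vs ws lin same =
      alt .linear (suc i) x (u ∷ us) (u ∷ vs) (u ∷ ws) lin λ
        { zero    _    j → refl , refl
        ; (suc k) k≢i → same k (k≢i ∘ ≡.cong suc)
        }
    fix-first u .adjacent p us = alt .adjacent (suc p) (u ∷ us)

    η : ∀ us → D us ≈ D (us zero ∷ tail us)
    η us = alt .cong λ { zero _ → refl ; (suc _) _ → refl }

    linear₀ : ∀ x v w us → D ((λ j → x * v j + w j) ∷ us) ≈ x * D (v ∷ us) + D (w ∷ us)
    linear₀ x v w us = alt .linear zero x _ _ _ (λ _ → refl) λ
      { zero    0≢0 → contradiction ≡.refl 0≢0
      ; (suc k) _ _ → refl , refl
      }

    linear₀-sum : ∀ {p} (x : Vector Carrier p) (v : Fin p → Vector Carrier m) w us →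
      D ((λ j → sum (λ k → x k * v k j) + w j) ∷ us) ≈
      sum (λ k → x k * D (v k ∷ us)) + D (w ∷ us)
    linear₀-sum {zero} x v w us = trans
      (alt .cong (∷-cong (λ j → +-identityˡ (w j)) (λ _ _ → refl)))
      (sym (+-identityˡ (D (w ∷ us))))
    linear₀-sum {suc p} x v w us = begin
      D ((λ j → (x zero * v zero j + rest j) + w j) ∷ us)
        ≈⟨ alt .cong (∷-cong (λ j → +-assoc _ _ _) (λ _ _ → refl)) ⟩
      D ((λ j → x zero * v zero j + (rest j + w j)) ∷ us)
        ≈⟨ linear₀ (x zero) (v zero) (λ j → rest j + w j) us ⟩
      x zero * D (v zero ∷ us) + D ((λ j → rest j + w j) ∷ us)
        ≈⟨ +-congˡ (linear₀-sum (tail x) (tail v) w us) ⟩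
      x zero * D (v zero ∷ us) + (sum (λ k → x (suc k) * D (v (suc k) ∷ us)) + D (w ∷ us))
        ≈⟨ +-assoc _ _ _ ⟨
      sum (λ k → x k * D (v k ∷ us)) + D (w ∷ us) ∎
      where
      rest : Vector Carrier m
      rest j = sum λ k → x (suc k) * v (suc k) j

  module _ {n m} {D : (Fin n → Vector Carrier m) → Carrier} (alt : Alternating D) where

    kills-0 : Kills D λ _ → 0#
    kills-0 us i us≈0 = begin
      -- A zero row satisfies 0 = (-1) * 0 + 0, so all three families in `linear` can be `us`
      -- itself.
      D us               ≈⟨ alt .linear i (- 1#) us us us
        (λ j → trans (us≈0 j) (sym (trans
          (+-cong (trans (*-congˡ (us≈0 j)) (zeroʳ _)) (us≈0 j)) (+-identityʳ 0#))))
        (λ _ _ _ → refl , refl) ⟩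
      - 1# * D us + D us ≈⟨ +-congʳ (-1*x≈-x (D us)) ⟩
      - D us + D us      ≈⟨ -‿inverseˡ (D us) ⟩
      0#                 ∎

    kills-linear : ∀ x {v w} → Kills D v → Kills D w → Kills D λ j → x * v j + w j
    kills-linear x {v} {w} kv kw us i us≈ = begin
      D us                          ≈⟨ alt .linear i x us (us [ v ]) (us [ w ])
        (λ j → trans (us≈ j) (+-cong (*-congˡ (sym (at v j))) (sym (at w j))))
        (λ k k≢i j → off v k k≢i j , off w k k≢i j) ⟩
      x * D (us [ v ]) + D (us [ w ]) ≈⟨ +-cong (*-congˡ (kv _ i (at v))) (kw _ i (at w)) ⟩
      x * 0# + 0#                   ≈⟨ trans (+-identityʳ _) (zeroʳ x) ⟩
      0#                            ∎
      where
      _[_] : (Fin n → Vector Carrier m) → Vector Carrier m → Fin n → Vector Carrier m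
      us [ v ] = updateAt us i (const v)
      at : ∀ v j → (us [ v ]) i j ≈ v j
      at v j = reflexive (≡.cong-app (updateAt-updates i us) j)
      off : ∀ v k → k ≢ i → ∀ j → us k j ≈ (us [ v ]) k j
      off v k k≢i j = sym (reflexive (≡.cong-app (updateAt-minimal k i us k≢i) j))

  swap₀₁ : ∀ {n m} {D : (Fin (suc (suc n)) → Vector Carrier m) → Carrier} → Alternating D →
    ∀ u v us → D (u ∷ v ∷ us) ≈ - D (v ∷ u ∷ us)
  swap₀₁ {m = m} {D} alt u v us = inverseˡ-unique _ _ (begin
    D (u ∷ v ∷ us) + D (v ∷ u ∷ us)
      ≈⟨ +-cong (+-identityˡ _) (+-identityʳ _) ⟨
    (0# + D (u ∷ v ∷ us)) + (D (v ∷ u ∷ us) + 0#)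
      ≈⟨ +-cong (+-congʳ (repeated u)) (+-congˡ (repeated v)) ⟨
    (D (u ∷ u ∷ us) + D (u ∷ v ∷ us)) + (D (v ∷ u ∷ us) + D (v ∷ v ∷ us))
      ≈⟨ +-cong (linear′ (fix-first alt u) u v us) (linear′ (fix-first alt v) u v us) ⟨
    D (u ∷ u+v ∷ us) + D (v ∷ u+v ∷ us)
      ≈⟨ linear′ alt u v (u+v ∷ us) ⟨
    D (u+v ∷ u+v ∷ us)
      ≈⟨ repeated u+v ⟩
    0# ∎)
    where
    u+v : Vector Carrier m
    u+v j = 1# * u j + v j
    repeated : ∀ w → D (w ∷ w ∷ us) ≈ 0#
    repeated w = alt .adjacent zero (w ∷ w ∷ us) λ _ → refl
    linear′ : ∀ {n} {D : (Fin (suc n) → Vector Carrier m) → Carrier} → Alternating D →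
      ∀ u v us → D ((λ j → 1# * u j + v j) ∷ us) ≈ D (u ∷ us) + D (v ∷ us)
    linear′ alt u v us = trans (linear₀ alt 1# u v us) (+-congʳ (*-identityˡ _))

  -- `adjacent` settles a copy of `u` right behind the first argument. For a later copy, exchanging
  -- the first two arguments and then fixing the new first one brings `u` one place closer.
  kills-first : ∀ {n m} {D : (Fin (suc n) → Vector Carrier m) → Carrier} → Alternating D →
    ∀ u → Kills (λ us → D (u ∷ us)) u
  kills-first alt u us zero    us≈u = alt .adjacent zero (u ∷ us) (sym ∘ us≈u)
  kills-first {D = D} alt u us (suc k) us≈u = begin
    D (u ∷ us)                      ≈⟨ η (fix-first alt u) us ⟩
    D (u ∷ us zero ∷ tail us)       ≈⟨ swap₀₁ alt u (us zero) (tail us) ⟩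
    - D (us zero ∷ u ∷ tail us)     ≈⟨ -‿cong
      (kills-first (fix-first alt (us zero)) u (tail us) k us≈u) ⟩
    - 0#                            ≈⟨ -0#≈0# ⟩
    0#                              ∎

  -- One exchange for each of the `j` arguments passed. The resulting sign is exactly the one in the
  -- Laplace expansion.
  move-to-front : ∀ {n m} {D : (Fin (suc n) → Vector Carrier m) → Carrier} → Alternating D →
    ∀ us j → D (us j ∷ removeAt us j) ≈ (- 1#) ^ toℕ j * D us
  move-to-front alt us zero = trans (sym (η alt us)) (sym (*-identityˡ _))
  move-to-front {suc n} {D = D} alt us (suc j) = begin
    D (us (suc j) ∷ removeAt us (suc j))
      ≈⟨ η (fix-first alt (us (suc j))) (removeAt us (suc j)) ⟩
    D (us (suc j) ∷ us zero ∷ removeAt (tail us) j)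
      ≈⟨ swap₀₁ alt _ _ _ ⟩
    - D (us zero ∷ us (suc j) ∷ removeAt (tail us) j)
      ≈⟨ -‿cong (move-to-front (fix-first alt (us zero)) (tail us) j) ⟩
    - ((- 1#) ^ toℕ j * D (us zero ∷ tail us))
      ≈⟨ -‿cong (*-congˡ (sym (η alt us))) ⟩
    - ((- 1#) ^ toℕ j * D us)
      ≈⟨ -1*x≈-x _ ⟨
    - 1# * ((- 1#) ^ toℕ j * D us)
      ≈⟨ *-assoc _ _ _ ⟨
    (- 1#) ^ toℕ (suc j) * D us ∎

  -- The summands zs carry the induction: after expanding D along the first
  -- row, the multiple of ws j in each later row is killed by D (ws j ∷_).
  -- Since D enters only through alternation, taking for D the determinant
  -- detᵀ as a function of its columns gives at once det (M · N) = det M * det N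
  -- and the invariance under transposition.
  alternating-combination : ∀ {n m} {D : (Fin n → Vector Carrier m) → Carrier} →
    Alternating D → (M : Matrix n) (ws zs : Fin n → Vector Carrier m) →
    (∀ i → Kills D (zs i)) →
    D (λ i j → sum (λ k → M i k * ws k j) + zs i j) ≈ det M * D ws
  alternating-combination {zero} alt M ws zs kills =
    trans (alt .cong λ ()) (sym (*-identityˡ _))
  alternating-combination {suc n} {m} {D} alt M ws zs kills = begin
    D vs
      ≈⟨ η alt vs ⟩
    D (vs zero ∷ tail vs)
      ≈⟨ linear₀-sum alt (M zero) ws (zs zero) (tail vs) ⟩
    sum (λ j → M zero j * D (ws j ∷ tail vs)) + D (zs zero ∷ tail vs)
      ≈⟨ +-cong (sum-cong-≋ summand) (kills zero _ zero λ _ → refl) ⟩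
    sum (λ j → laplace j * D ws) + 0#
      ≈⟨ +-identityʳ _ ⟩
    sum (λ j → laplace j * D ws)
      ≈⟨ *-distribʳ-sum {suc n} (D ws) laplace ⟨
    det M * D ws ∎
    where
    vs : Fin (suc n) → Vector Carrier m
    vs i j = sum (λ k → M i k * ws k j) + zs i j
    minor : Fin (suc n) → Matrix n
    minor j a b = M (suc a) (punchIn j b)
    laplace : Vector Carrier (suc n)
    laplace j = (- 1#) ^ toℕ j * (M zero j * det (minor j))
    split : ∀ j a b → vs (suc a) b ≈
      sum (λ k → minor j a k * ws (punchIn j k) b) + (M (suc a) j * ws j b + zs (suc a) b)
    split j a b = trans (+-congʳ (sum-remove {i = j} λ k → M (suc a) k * ws k b))
      (solve 3 (λ x y z → (x :+ y) :+ z := y :+ (x :+ z)) refl _ _ _)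
    summand : ∀ j → M zero j * D (ws j ∷ tail vs) ≈ laplace j * D ws
    summand j = begin
      M zero j * D (ws j ∷ tail vs)
        ≈⟨ *-congˡ (fix-first alt (ws j) .cong (split j)) ⟩
      M zero j * D (ws j ∷ _)
        ≈⟨ *-congˡ (alternating-combination (fix-first alt (ws j)) (minor j) (removeAt ws j) _
             λ a → kills-linear (fix-first alt (ws j)) (M (suc a) j)
               (kills-first alt (ws j)) λ us i → kills (suc a) (ws j ∷ us) (suc i)) ⟩
      M zero j * (det (minor j) * D (ws j ∷ removeAt ws j))
        ≈⟨ *-congˡ (*-congˡ (move-to-front alt ws j)) ⟩
      M zero j * (det (minor j) * ((- 1#) ^ toℕ j * D ws))
        ≈⟨ solve 4 (λ x d s w → x :* (d :* (s :* w)) := (s :* (x :* d)) :* w) refl _ _ _ _ ⟩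
      laplace j * D ws ∎

  -- The determinant as a function of its columns

  detᵀ : ∀ {n} → Matrix n → Carrier
  detᵀ M = det λ i j → M j i

  -- Expansion along the first row treats all columns alike, so multilinearity in the columns is a
  -- direct induction. The term of index `j = i` is linear through its entry, and its minor omits
  -- the varied vector; for `j ≢ i` the varied vector lies in the minor, at index `punchOut j≢i`.
  detᵀ-linear : ∀ {n} i x (us vs ws : Matrix n) → (∀ j → us i j ≈ x * vs i j + ws i j) →
    (∀ k → k ≢ i → ∀ j → us k j ≈ vs k j × us k j ≈ ws k j) →
    detᵀ us ≈ x * detᵀ vs + detᵀ ws
  detᵀ-linear {suc n} i x us vs ws lin same = begin
    sum (term us)                          ≈⟨ sum-cong-≋ summand ⟩
    sum (λ j → x * term vs j + term ws j)  ≈⟨ ∑-distrib-+ {suc n} (λ j → x * term vs j) (term ws) ⟩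
    sum (λ j → x * term vs j) + detᵀ ws    ≈⟨ +-congʳ (*-distribˡ-sum {suc n} x (term vs)) ⟨
    x * detᵀ vs + detᵀ ws                  ∎
    where
    minor : Matrix (suc n) → Fin (suc n) → Matrix n
    minor M j b a = M (punchIn j b) (suc a)
    term : Matrix (suc n) → Fin (suc n) → Carrier
    term M j = (- 1#) ^ toℕ j * (M j zero * detᵀ (minor M j))
    summand : ∀ j → term us j ≈ x * term vs j + term ws j
    summand j with j ≟ i
    ... | yes ≡.refl = begin
      s * (us j zero * detᵀ (minor us j))
        ≈⟨ *-congˡ (*-congʳ (lin zero)) ⟩
      s * ((x * vs j zero + ws j zero) * detᵀ (minor us j))
        ≈⟨ solve 5 (λ s x v w d → s :* ((x :* v :+ w) :* d) :=
             x :* (s :* (v :* d)) :+ s :* (w :* d)) refl _ _ _ _ _ ⟩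
      x * (s * (vs j zero * detᵀ (minor us j))) + s * (ws j zero * detᵀ (minor us j))
        ≈⟨ +-cong
             (*-congˡ (*-congˡ (*-congˡ (det-cong λ a b → proj₁ (off b (suc a))))))
             (*-congˡ (*-congˡ (det-cong λ a b → proj₂ (off b (suc a))))) ⟩
      x * term vs j + term ws j ∎
      where
      s = (- 1#) ^ toℕ j
      off : ∀ b a → us (punchIn j b) a ≈ vs (punchIn j b) a × us (punchIn j b) a ≈ ws (punchIn j b) a
      off b a = same (punchIn j b) (punchInᵢ≢i j b) a
    ... | no j≢i = begin
      s * (us j zero * detᵀ (minor us j))
        ≈⟨ *-congˡ (*-congˡ (detᵀ-linear (punchOut j≢i) x _ (minor vs j) (minor ws j)
             (λ a → ≡.subst (λ i → us i (suc a) ≈ x * vs i (suc a) + ws i (suc a))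
               (≡.sym (punchIn-punchOut j≢i)) (lin (suc a)))
             λ k k≢ a → same (punchIn j k)
               (λ eq → k≢ (punchIn-injective j k _ (≡.trans eq (≡.sym (punchIn-punchOut j≢i)))))
               (suc a))) ⟩
      s * (us j zero * (x * detᵀ (minor vs j) + detᵀ (minor ws j)))
        ≈⟨ solve 5 (λ s x u d e → s :* (u :* (x :* d :+ e)) :=
             x :* (s :* (u :* d)) :+ s :* (u :* e)) refl _ _ _ _ _ ⟩
      x * (s * (us j zero * detᵀ (minor vs j))) + s * (us j zero * detᵀ (minor ws j))
        ≈⟨ +-cong
             (*-congˡ (*-congˡ (*-congʳ (proj₁ (same j j≢i zero)))))
             (*-congˡ (*-congʳ (proj₂ (same j j≢i zero)))) ⟩
      x * term vs j + term ws j ∎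
      where s = (- 1#) ^ toℕ j

  adjacent-sign : ∀ {n} {i k : Fin n} → Adjacent i k → (- 1#) ^ toℕ k ≡ - 1# * (- 1#) ^ toℕ i
  adjacent-sign zero    = ≡.refl
  adjacent-sign (suc p) = ≡.cong (- 1# *_) (adjacent-sign p)

  -- The terms of index `i` and `k` have equal entries, equal minors and opposite signs. Every other
  -- minor still contains both equal neighbours and vanishes by induction.
  detᵀ-adjacent : ∀ {n} {i k : Fin n} → Adjacent i k → (us : Matrix n) →
    (∀ j → us i j ≈ us k j) → detᵀ us ≈ 0#
  detᵀ-adjacent {suc n} {i} {k} p us eq = sum-adjacent p cancel vanish
    where
    minor : Fin (suc n) → Matrix n
    minor j b a = us (punchIn j b) (suc a)
    same-minor : ∀ b a → minor k b a ≈ minor i b a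
    same-minor b a with punchIn-adjacent p b
    ... | inj₁ e        = reflexive (≡.cong (λ l → us l (suc a)) (≡.sym e))
    ... | inj₂ (e , e′) = trans (reflexive (≡.cong (λ l → us l (suc a)) e′))
      (trans (eq (suc a)) (reflexive (≡.cong (λ l → us l (suc a)) (≡.sym e))))
    s = (- 1#) ^ toℕ i
    t = us i zero * detᵀ (minor i)
    cancel : s * t + (- 1#) ^ toℕ k * (us k zero * detᵀ (minor k)) ≈ 0#
    cancel = begin
      s * t + (- 1#) ^ toℕ k * (us k zero * detᵀ (minor k))
        ≈⟨ +-congˡ (*-cong (reflexive (adjacent-sign p))
             (*-cong (sym (eq zero)) (det-cong λ a b → same-minor b a))) ⟩
      s * t + - 1# * s * t ≈⟨ +-congˡ (*-assoc _ _ _) ⟩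
      s * t + - 1# * (s * t) ≈⟨ +-congˡ (-1*x≈-x _) ⟩
      s * t + - (s * t)    ≈⟨ -‿inverseʳ _ ⟩
      0#                   ∎
    vanish : ∀ j → j ≢ i → j ≢ k → (- 1#) ^ toℕ j * (us j zero * detᵀ (minor j)) ≈ 0#
    vanish j j≢i j≢k with adjacent-punchIn j p j≢i j≢k
    ... | i′ , k′ , p′ , ≡.refl , ≡.refl = begin
      (- 1#) ^ toℕ j * (us j zero * detᵀ (minor j))
        ≈⟨ *-congˡ (*-congˡ (detᵀ-adjacent p′ (minor j) λ a → eq (suc a))) ⟩
      (- 1#) ^ toℕ j * (us j zero * 0#) ≈⟨ trans (*-congˡ (zeroʳ _)) (zeroʳ _) ⟩
      0# ∎

  detᵀ-alternating : ∀ {n} → Alternating {n} {n} detᵀ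
  detᵀ-alternating .cong us≈vs = det-cong λ i j → us≈vs j i
  detᵀ-alternating .linear     = detᵀ-linear
  detᵀ-alternating .adjacent   = detᵀ-adjacent

  detᵀ-1 : ∀ n → detᵀ {n} (scalar 1#) ≈ 1#
  detᵀ-1 zero    = refl
  detᵀ-1 (suc n) = begin
    1# * (1# * detᵀ {n} (scalar 1#)) + sum (λ j → (- 1#) ^ toℕ (suc j) * (0# * minor j))
      ≈⟨ +-cong (trans (*-identityˡ _) (trans (*-identityˡ _) (detᵀ-1 n)))
           (sum-zero {n} λ j → trans (*-congˡ (zeroˡ (minor j))) (zeroʳ _)) ⟩
    1# + 0# ≈⟨ +-identityʳ 1# ⟩
    1# ∎
    where
    minor : Fin n → Carrier
    minor j = detᵀ {n} λ b a → scalar 1# (punchIn (suc j) b) (suc a)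

  -- The rows of `M · N` are combinations of the rows of `N` with coefficients from `M`. The formula
  -- is asymmetric in `det` and `detᵀ`, so taking the identity for `N` compares the two.
  detᵀ-· : ∀ {n} (M N : Matrix n) → detᵀ (M · N) ≈ det M * detᵀ N
  detᵀ-· {n} M N = trans
    (detᵀ-alternating .cong {us = M · N} λ i j → sym (+-identityʳ _))
    (alternating-combination {n} detᵀ-alternating M N (λ _ _ → 0#)
      λ _ → kills-0 detᵀ-alternating)

  detᵀ≈det : ∀ {n} (M : Matrix n) → detᵀ M ≈ det M
  detᵀ≈det {n} M = begin
    detᵀ M                    ≈⟨ det-cong (λ i j → sum-scalar (M j) i) ⟨
    detᵀ (M · scalar 1#)      ≈⟨ detᵀ-· M (scalar 1#) ⟩
    det M * detᵀ {n} (scalar 1#)  ≈⟨ *-congˡ (detᵀ-1 n) ⟩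
    det M * 1#                ≈⟨ *-identityʳ _ ⟩
    det M                     ∎

  det-· : ∀ {n} (M N : Matrix n) → det (M · N) ≈ det M * det N
  det-· M N = begin
    det (M · N)    ≈⟨ detᵀ≈det (M · N) ⟨
    detᵀ (M · N)   ≈⟨ detᵀ-· M N ⟩
    det M * detᵀ N ≈⟨ *-congˡ (detᵀ≈det N) ⟩
    det M * det N  ∎

  det-similar : ∀ {n} (P Q : Matrix n) → (∀ i j → (P · Q) i j ≈ scalar 1# i j) →
    ∀ M → det (P · (M · Q)) ≈ det M
  det-similar {n} P Q PQ≈1 M = begin
    det (P · (M · Q))         ≈⟨ det-· P (M · Q) ⟩
    det P * det (M · Q)       ≈⟨ *-congˡ (det-· M Q) ⟩
    det P * (det M * det Q)   ≈⟨ solve 3 (λ p m q → p :* (m :* q) := (p :* q) :* m) refl _ _ _ ⟩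
    det P * det Q * det M     ≈⟨ *-congʳ (det-· P Q) ⟨
    det (P · Q) * det M       ≈⟨ *-congʳ (det-cong PQ≈1) ⟩
    det {n} (scalar 1#) * det M ≈⟨ *-congʳ (trans (sym (detᵀ≈det {n} (scalar 1#))) (detᵀ-1 n)) ⟩
    1# * det M                ≈⟨ *-identityˡ _ ⟩
    det M                     ∎

-- Conjugation by a sparse matrix

open import Data.List using (List; []; _∷_)
open import Data.List.Membership.DecPropositional (≡-dec (_≟_ {2}) (_≟_ {2})) using (_∈?_)

module SparseConjugation {c ℓ} (R : CommutativeRing c ℓ) where
  open CommutativeRing R hiding (zero)
  open Matrices R
  open Determinant R
  open import Algebra.Properties.Semiring.Sum semiring
    using (sum-cong-≋; ∑-distrib-+; *-distribˡ-sum)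
  open import Algebra.Solver.Ring.NaturalCoefficients.Default commutativeSemiring
    using (solve; _:=_; _:+_; _:*_)
  open import Relation.Binary.Reasoning.Setoid setoid

  -- A list of weighted positions, because pairing with it unfolds to an explicit sum of a few
  -- terms, whereas a sum over `Fin n` is stuck for variable `n`.
  Functional : ℕ → Set c
  Functional n = List (Carrier × Fin n)

  ⟨_,_⟩ : ∀ {n} → Functional n → Vector Carrier n → Carrier
  ⟨ []          , y ⟩ = 0#
  ⟨ (x , p) ∷ L , y ⟩ = x * y p + ⟨ L , y ⟩

  ⟨⟩-cong : ∀ {n} (L : Functional n) {y z} → (∀ p → y p ≈ z p) → ⟨ L , y ⟩ ≈ ⟨ L , z ⟩
  ⟨⟩-cong []            y≈z = refl
  ⟨⟩-cong ((x , p) ∷ L) y≈z = +-cong (*-congˡ (y≈z p)) (⟨⟩-cong L y≈z)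

  ⟨⟩-+ : ∀ {n} (L : Functional n) y z → ⟨ L , (λ p → y p + z p) ⟩ ≈ ⟨ L , y ⟩ + ⟨ L , z ⟩
  ⟨⟩-+ []            y z = sym (+-identityˡ 0#)
  ⟨⟩-+ ((x , p) ∷ L) y z = trans (+-congˡ (⟨⟩-+ L y z))
    (solve 5 (λ x y z s t → x :* (y :+ z) :+ (s :+ t) := (x :* y :+ s) :+ (x :* z :+ t))
      refl x (y p) (z p) _ _)

  ⟨⟩-* : ∀ {n} (L : Functional n) x y → ⟨ L , (λ p → x * y p) ⟩ ≈ x * ⟨ L , y ⟩
  ⟨⟩-* []            x y = sym (zeroʳ x)
  ⟨⟩-* ((w , p) ∷ L) x y = trans (+-congˡ (⟨⟩-* L x y))
    (solve 4 (λ w x y t → w :* (x :* y) :+ x :* t := x :* (w :* y :+ t)) refl w x (y p) _)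

  column : ∀ {n} → (Fin n → Functional n) → Matrix n
  column L k j = ⟨ L j , scalar 1# k ⟩

  sum-functional : ∀ {n} (L : Functional n) y →
    sum (λ k → y k * ⟨ L , scalar 1# k ⟩) ≈ ⟨ L , y ⟩
  sum-functional [] y = sum-zero λ k → zeroʳ (y k)
  sum-functional {n} ((x , p) ∷ L) y = begin
    sum (λ k → y k * (x * scalar 1# k p + ⟨ L , scalar 1# k ⟩))
      ≈⟨ sum-cong-≋ {n} (λ k → solve 4 (λ y x s t → y :* (x :* s :+ t) := x :* (y :* s) :+ y :* t)
           refl (y k) x (scalar 1# k p) ⟨ L , scalar 1# k ⟩) ⟩
    sum (λ k → x * (y k * scalar 1# k p) + y k * ⟨ L , scalar 1# k ⟩)
      ≈⟨ ∑-distrib-+ {n} (λ k → x * (y k * scalar 1# k p)) (λ k → y k * ⟨ L , scalar 1# k ⟩) ⟩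
    sum (λ k → x * (y k * scalar 1# k p)) + sum (λ k → y k * ⟨ L , scalar 1# k ⟩)
      ≈⟨ +-cong (sym (*-distribˡ-sum {n} x (λ k → y k * scalar 1# k p))) (sum-functional L y) ⟩
    x * sum (λ k → y k * scalar 1# k p) + ⟨ L , y ⟩
      ≈⟨ +-congʳ (*-congˡ (sum-scalar y p)) ⟩
    x * y p + ⟨ L , y ⟩ ∎

  -- Qᵀ M Q, where the functional L w is the column w of Q.
  conjugate : ∀ {n} → (Fin n → Functional n) → Matrix n → Matrix n
  conjugate L M u w = ⟨ L u , (λ p → ⟨ L w , M p ⟩) ⟩

  module _ {n} (L : Fin n → Functional n) where

    conjugate-cong : ∀ {M N} → (∀ i j → M i j ≈ N i j) →
      ∀ u w → conjugate L M u w ≈ conjugate L N u w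
    conjugate-cong M≈N u w = ⟨⟩-cong (L u) λ p → ⟨⟩-cong (L w) (M≈N p)

    conjugate-+ : ∀ M N u w →
      conjugate L (λ i j → M i j + N i j) u w ≈ conjugate L M u w + conjugate L N u w
    conjugate-+ M N u w = trans
      (⟨⟩-cong (L u) λ p → ⟨⟩-+ (L w) (M p) (N p))
      (⟨⟩-+ (L u) _ _)

    conjugate-* : ∀ x M u w →
      conjugate L (λ i j → x * M i j) u w ≈ x * conjugate L M u w
    conjugate-* x M u w = trans
      (⟨⟩-cong (L u) λ p → ⟨⟩-* (L w) x (M p))
      (⟨⟩-* (L u) x _)

    -- The first hypothesis is QᵀJQ = J. It lets one and the same Q serve every `r`.
    conjugate-translate : (∀ u w → conjugate L (λ _ _ → 1#) u w ≈ 1#) →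
      ∀ {M N : Matrix n} → (∀ u w → conjugate L M u w ≈ N u w) →
      ∀ r u w → conjugate L (λ i j → M i j + r) u w ≈ N u w + r
    conjugate-translate 1→1 {M} {N} M→N r u w = begin
      conjugate L (λ i j → M i j + r) u w
        ≈⟨ conjugate-cong {λ i j → M i j + r} (λ i j → +-congˡ {M i j} (sym (*-identityʳ r))) u w ⟩
      conjugate L (λ i j → M i j + r * 1#) u w
        ≈⟨ conjugate-+ M (λ _ _ → r * 1#) u w ⟩
      conjugate L M u w + conjugate L (λ _ _ → r * 1#) u w
        ≈⟨ +-cong (M→N u w) (conjugate-* r (λ _ _ → 1#) u w) ⟩
      N u w + r * conjugate L (λ _ _ → 1#) u w
        ≈⟨ +-congˡ (trans (*-congˡ (1→1 u w)) (*-identityʳ r)) ⟩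
      N u w + r ∎

    det-conjugate : (∀ u w → conjugate L (scalar 1#) u w ≈ scalar 1# u w) →
      ∀ M → det (conjugate L M) ≈ det M
    det-conjugate orthogonal M = begin
      det (conjugate L M)     ≈⟨ det-cong (λ u w → trans (Qᵀ· (M · Q) u w)
        (⟨⟩-cong (L u) λ p → sum-functional (L w) (M p))) ⟨
      det (Qᵀ · (M · Q))      ≈⟨ det-similar Qᵀ Q (λ u w → trans (Qᵀ· Q u w) (orthogonal u w)) M ⟩
      det M                   ∎
      where
      Q Qᵀ : Matrix n
      Q      = column L
      Qᵀ i j = Q j i
      Qᵀ· : ∀ N u w → (Qᵀ · N) u w ≈ ⟨ L u , (λ p → N p w) ⟩
      Qᵀ· N u w = trans (sum-cong-≋ {n} λ k → *-comm _ _) (sum-functional (L u) λ p → N p w)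

    charpoly-conjugate : (∀ u w → conjugate L (scalar 1#) u w ≈ scalar 1# u w) →
      ∀ {M N : Matrix n} → (∀ u w → conjugate L M u w ≈ N u w) → ∀ x → charpoly N x ≈ charpoly M x
    charpoly-conjugate orthogonal {M} {N} M→N x = begin
      charpoly N x
        ≈⟨ det-cong (λ u w → sym (trans (conjugate-+ (scalar x) (λ i j → - M i j) u w)
             (+-cong (scalar′ u w) (negated u w)))) ⟩
      det (conjugate L (λ i j → scalar x i j - M i j))
        ≈⟨ det-conjugate orthogonal _ ⟩
      charpoly M x ∎
      where
      open import Algebra.Properties.Ring ring using (-1*x≈-x)
      scalar-1# : ∀ i j → x * scalar 1# i j ≈ scalar {n} x i j
      scalar-1# i j with does (i ≟ j)
      ... | true  = *-identityʳ x
      ... | false = zeroʳ x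
      scalar′ : ∀ u w → conjugate L (scalar x) u w ≈ scalar x u w
      scalar′ u w = begin
        conjugate L (scalar x) u w                  ≈⟨ conjugate-cong scalar-1# u w ⟨
        conjugate L (λ i j → x * scalar 1# i j) u w ≈⟨ conjugate-* x (scalar 1#) u w ⟩
        x * conjugate L (scalar 1#) u w             ≈⟨ *-congˡ (orthogonal u w) ⟩
        x * scalar 1# u w                           ≈⟨ scalar-1# u w ⟩
        scalar x u w                                ∎
      negated : ∀ u w → conjugate L (λ i j → - M i j) u w ≈ - N u w
      negated u w = begin
        conjugate L (λ i j → - M i j) u w      ≈⟨ conjugate-cong (λ i j → -1*x≈-x (M i j)) u w ⟨
        conjugate L (λ i j → - 1# * M i j) u w ≈⟨ conjugate-* (- 1#) M u w ⟩
        - 1# * conjugate L M u w               ≈⟨ -1*x≈-x _ ⟩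
        - conjugate L M u w                    ≈⟨ -‿cong (M→N u w) ⟩
        - N u w                                ∎

-- Entries of QᵀMQ as finite computations

⟦_⟧ : Bool → ℚ
⟦ b ⟧ = if b then 1ℚ else 0ℚ

Block : Set → Set
Block A = Fin 2 → Fin 2 → A

-- The entry at vᵢα of yᵀQ, where y and y′ are the entries of the vector on Cᵢ
-- and on Cᵢ₊₁.
mixed : (y y′ : Fin 2 → ℚ) → Fin 2 → ℚ
mixed y y′ α =
  ½ ℚ.* y #1 ℚ.+ (½ ℚ.* y #2 ℚ.+ (½ ℚ.* y′ α ℚ.+ (ℚ.- ½ ℚ.* y′ (opposite α) ℚ.+ 0ℚ)))

mixed-cong : ∀ {y y′ z z′} → (∀ α → y α ≡ z α) → (∀ α → y′ α ≡ z′ α) →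
  ∀ α → mixed y y′ α ≡ mixed z z′ α
mixed-cong e e′ α rewrite e #1 | e #2 | e′ α | e′ (opposite α) = ≡.refl

-- `#1` stands for the constant component, which stays in place, and `#2` for the component of sum
-- zero, which is moved by S.
shift : Fin 2 → ℤ₅ → ℤ₅
shift #1 i = i
shift #2 i = i ⊕ 1

-- The entry at (vᵢα , vⱼβ) of QᵀMQ, where B k l is the block of M at
-- (shift k i , shift l j).
mixed₂ : (Fin 2 → Fin 2 → Block Bool) → Block ℚ
mixed₂ B α β = mixed (row #1) (row #2) α
  where
  row : Fin 2 → Fin 2 → ℚ
  row k γ = mixed (λ ε → ⟦ B k #1 γ ε ⟧) (λ ε → ⟦ B k #2 γ ε ⟧) β

mixed₂-cong : ∀ {B B′} → (∀ k l α β → B k l α β ≡ B′ k l α β) → ∀ α β → mixed₂ B α β ≡ mixed₂ B′ α β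
mixed₂-cong e α β = mixed-cong (row #1) (row #2) α
  where
  row = λ k γ → mixed-cong (λ ε → ≡.cong ⟦_⟧ (e k #1 γ ε)) (λ ε → ≡.cong ⟦_⟧ (e k #2 γ ε)) β

-- The two edge sets admitted in each case for Cᵢ ∪ Cᵢ₊₁, respectively Cᵢ ∪ Cᵢ₊₂.
edges₁ edges₂ : Case → Fin 2 → List (Fin 2 × Fin 2)
edges₁ caseA #1 = []
edges₁ caseA #2 = (#1 , #1) ∷ (#1 , #2) ∷ (#2 , #1) ∷ (#2 , #2) ∷ []
edges₁ caseB #1 = (#1 , #1) ∷ (#2 , #2) ∷ []
edges₁ caseB #2 = (#1 , #2) ∷ (#2 , #1) ∷ []
edges₁ caseC #1 = (#1 , #1) ∷ (#1 , #2) ∷ []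
edges₁ caseC #2 = (#2 , #1) ∷ (#2 , #2) ∷ []
edges₂ caseA #1 = (#1 , #1) ∷ (#1 , #2) ∷ []
edges₂ caseA #2 = (#2 , #1) ∷ (#2 , #2) ∷ []
edges₂ caseB #1 = (#1 , #1) ∷ (#1 , #2) ∷ []
edges₂ caseB #2 = (#2 , #1) ∷ (#2 , #2) ∷ []
edges₂ caseC #1 = (#1 , #1) ∷ (#2 , #1) ∷ []
edges₂ caseC #2 = (#1 , #2) ∷ (#2 , #2) ∷ []

-- Offsets 3 and 4 are offsets 2 and 1 seen from the other end, since (i + 3) + 2 = i = (i + 4) + 1.
-- Hence the transposed edge sets.
shape : Case → ℤ₅ → Fin 2 → Block Bool
shape κ 0F s α β = false
shape κ 1F s α β = does ((α , β) ∈? edges₁ κ s)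
shape κ 2F s α β = does ((α , β) ∈? edges₂ κ s)
shape κ 3F s α β = does ((β , α) ∈? edges₂ κ s)
shape κ 4F s α β = does ((β , α) ∈? edges₁ κ s)

-- (shift l j) - (shift k i) when j - i = δ.
offset : Fin 2 → Fin 2 → ℤ₅ → ℤ₅
offset k l δ = shift l δ ⊖ shift k zero

-- With (k , l) = source κ (j ⊖ i), the block of Γ′ at (i , j) is the block of Γ
-- at (shift k i , shift l j).
source : Case → ℤ₅ → Fin 2 × Fin 2
source κ     0F = #1 , #1
source caseA 1F = #1 , #1
source caseA 2F = #1 , #2
source caseA 3F = #2 , #1
source caseA 4F = #1 , #1
source caseB 1F = #2 , #2
source caseB 2F = #1 , #2
source caseB 3F = #2 , #1
source caseB 4F = #2 , #2
source caseC 1F = #1 , #2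
source caseC 2F = #2 , #1
source caseC 3F = #1 , #2
source caseC 4F = #2 , #1

select : ∀ {A : Set} → A → A → A → A → Fin 2 → Fin 2 → A
select w x y z #1 #1 = w
select w x y z #1 #2 = x
select w x y z #2 #1 = y
select w x y z #2 #2 = z

-- The four blocks that enter one block of QᵀAQ matter only through their offsets and the
-- alternatives chosen for them. This leaves, in each case, five offsets, sixteen choices and four
-- entries to evaluate.
mixed₂-shape? : ∀ κ → Dec (∀ δ s₁₁ s₁₂ s₂₁ s₂₂ α β → let k , l = source κ δ in
  mixed₂ (λ k l → shape κ (offset k l δ) (select s₁₁ s₁₂ s₂₁ s₂₂ k l)) α β ≡
  ⟦ shape κ (offset k l δ) (select s₁₁ s₁₂ s₂₁ s₂₂ k l) α β ⟧)
mixed₂-shape? κ = all? λ δ → all? λ s₁₁ → all? λ s₁₂ → all? λ s₂₁ → all? λ s₂₂ →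
  all? λ α → all? λ β → _ ℚ.≟ _

mixed₂-shape : ∀ κ δ s₁₁ s₁₂ s₂₁ s₂₂ α β → let k , l = source κ δ in
  mixed₂ (λ k l → shape κ (offset k l δ) (select s₁₁ s₁₂ s₂₁ s₂₂ k l)) α β ≡
  ⟦ shape κ (offset k l δ) (select s₁₁ s₁₂ s₂₁ s₂₂ k l) α β ⟧
mixed₂-shape caseA = from-yes (mixed₂-shape? caseA)
mixed₂-shape caseB = from-yes (mixed₂-shape? caseB)
mixed₂-shape caseC = from-yes (mixed₂-shape? caseC)

same : Block Bool
same α β = does (α ≟ β)

-- Orthogonality of E ⊗ I + F ⊗ S: the cross terms contain EF = FE = 0, and EE + FF = I.
mixed₂-same : ∀ i j α β →
  mixed₂ (λ k l α β → does (shift k i ≟ shift l j) ∧ same α β) α β ≡ ⟦ does (i ≟ j) ∧ same α β ⟧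
mixed₂-same = from-yes (all? λ i → all? λ j → all? λ α → all? λ β →
  mixed₂ (λ k l α β → does (shift k i ≟ shift l j) ∧ same α β) α β ℚ.≟ ⟦ does (i ≟ j) ∧ same α β ⟧)

-- Index arithmetic modulo 5

⊕-assoc : ∀ i (k l : ℤ₅) → (i ⊕ toℕ k) ⊕ toℕ l ≡ i ⊕ toℕ (k ⊕ toℕ l)
⊕-assoc = from-yes (all? λ i → all? λ (k : ℤ₅) → all? λ (l : ℤ₅) → (i ⊕ toℕ k) ⊕ toℕ l ≟ i ⊕ toℕ (k ⊕ toℕ l))

⊕-identityʳ : ∀ i → i ⊕ 0 ≡ i
⊕-identityʳ = from-yes (all? λ i → i ⊕ 0 ≟ i)

⊖-⊕ : ∀ i j → i ⊕ toℕ (j ⊖ i) ≡ j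
⊖-⊕ = from-yes (all? λ i → all? λ j → i ⊕ toℕ (j ⊖ i) ≟ j)

offset-shift : ∀ k l i j → shift k i ⊕ toℕ (offset k l (j ⊖ i)) ≡ shift l j
offset-shift = from-yes (all? λ k → all? λ l → all? λ i → all? λ j →
  shift k i ⊕ toℕ (offset k l (j ⊖ i)) ≟ shift l j)

≡-does : ∀ {b} {A : Set} → b ≡ true ⇔ A → (A? : Dec A) → b ≡ does A?
≡-does {true}  b⇔A A? = ≡.sym (dec-true A? (Equivalence.to b⇔A ≡.refl))
≡-does {false} b⇔A A? = ≡.sym (dec-false A? λ a → contradiction (Equivalence.from b⇔A a) λ ())

-- Rows of vertices of D

count : (Fin 2 → Bool) → ℕ
count y = boolToℕ (y #1) ℕ.+ boolToℕ (y #2)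

count-parity : ∀ y → count y ≡ 1 ⊎ count y % 2 ≡ 0
count-parity y with y #1 | y #2
... | true  | true  = inj₂ ≡.refl
... | true  | false = inj₁ ≡.refl
... | false | true  = inj₁ ≡.refl
... | false | false = inj₂ ≡.refl

-- Zero or two neighbours make a constant vector. So Fy′ = 0 and Ey = y.
mixed-even : ∀ y y′ → count y % 2 ≡ 0 → count y′ % 2 ≡ 0 →
  ∀ α → mixed (⟦_⟧ ∘ y) (⟦_⟧ ∘ y′) α ≡ ⟦ y α ⟧
mixed-even y y′ even even′ #1 with y #1 | y #2 | y′ #1 | y′ #2
... | true  | true  | true  | true  = ≡.refl
... | true  | true  | false | false = ≡.refl
... | false | false | true  | true  = ≡.refl
... | false | false | false | false = ≡.refl
mixed-even y y′ even even′ #2 with y #1 | y #2 | y′ #1 | y′ #2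
... | true  | true  | true  | true  = ≡.refl
... | true  | true  | false | false = ≡.refl
... | false | false | true  | true  = ≡.refl
... | false | false | false | false = ≡.refl

-- With one neighbour in each pair, Ey and Ey′ are both (½, ½), so Ey + Fy′ = Ey′ + Fy′ = y′.
mixed-one : ∀ y y′ → count y ≡ 1 → count y′ ≡ 1 →
  ∀ α → mixed (⟦_⟧ ∘ y) (⟦_⟧ ∘ y′) α ≡ ⟦ y′ α ⟧
mixed-one y y′ one one′ #1 with y #1 | y #2 | y′ #1 | y′ #2
... | true  | false | true  | false = ≡.refl
... | true  | false | false | true  = ≡.refl
... | false | true  | true  | false = ≡.refl
... | false | true  | false | true  = ≡.refl
mixed-one y y′ one one′ #2 with y #1 | y #2 | y′ #1 | y′ #2
... | true  | false | true  | false = ≡.refl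
... | true  | false | false | true  = ≡.refl
... | false | true  | true  | false = ≡.refl
... | false | true  | false | true  = ≡.refl

unit-weight : ∀ p → 1ℚ ℚ.* p ℚ.+ 0ℚ ≡ p
unit-weight p = ≡.trans (ℚ.+-identityʳ (1ℚ ℚ.* p)) (ℚ.*-identityˡ p)

-- The switching

open Matrices ℝ-commutativeRing
open SparseConjugation ℝ-commutativeRing

module _ {n} (Γ : Graph n) (P : Partition n) where
  open Partition P

  Uniform : Case → ℤ₅ → ℤ₅ → Fin 2 → Set
  Uniform κ i δ s = ∀ α β → adj Γ (v i α) (v (i ⊕ toℕ δ) β) ≡ shape κ δ s α β

  edgeSet⇒adj : ∀ {i j es} → EdgeSet Γ P i j es → ∀ α β → adj Γ (v i α) (v j β) ≡ does ((α , β) ∈? es)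
  edgeSet⇒adj (edges , _) α β = ≡-does (edges α β) ((α , β) ∈? _)

  block₁ : ∀ κ → CaseCondition Γ P κ → ∀ i → ∃ (Uniform κ i 1F)
  block₁ caseA cond i = [ (λ e → #1 , edgeSet⇒adj e) , (λ e → #2 , edgeSet⇒adj e) ] (proj₁ (cond i))
  block₁ caseB cond i = [ (λ e → #1 , edgeSet⇒adj e) , (λ e → #2 , edgeSet⇒adj e) ] (proj₁ (cond i))
  block₁ caseC cond i = [ (λ e → #1 , edgeSet⇒adj e) , (λ e → #2 , edgeSet⇒adj e) ] (proj₁ (cond i))

  block₂ : ∀ κ → CaseCondition Γ P κ → ∀ i → ∃ (Uniform κ i 2F)
  block₂ caseA cond i = [ (λ e → #1 , edgeSet⇒adj e) , (λ e → #2 , edgeSet⇒adj e) ] (proj₂ (cond i))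
  block₂ caseB cond i = [ (λ e → #1 , edgeSet⇒adj e) , (λ e → #2 , edgeSet⇒adj e) ] (proj₂ (cond i))
  block₂ caseC cond i = [ (λ e → #1 , edgeSet⇒adj e) , (λ e → #2 , edgeSet⇒adj e) ] (proj₂ (cond i))

  edgeless : ∀ κ → CaseCondition Γ P κ → ∀ i α β → adj Γ (v i α) (v i β) ≡ false
  edgeless caseA cond i = [ proj₁ ∘ proj₂ , proj₁ ∘ proj₂ ] (proj₁ (cond i))
  edgeless caseB cond i = [ proj₁ ∘ proj₂ , proj₁ ∘ proj₂ ] (proj₁ (cond i))
  edgeless caseC cond i = [ proj₁ ∘ proj₂ , proj₁ ∘ proj₂ ] (proj₁ (cond i))

  reversed : ∀ {i α} j β {i′} → i′ ≡ i → adj Γ (v i α) (v j β) ≡ adj Γ (v j β) (v i′ α)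
  reversed j β ≡.refl = symmetric Γ _ _

  blocks : ∀ κ → CaseCondition Γ P κ → ∀ i δ → ∃ (Uniform κ i δ)
  blocks κ cond i 0F = #1 , λ α β →
    ≡.trans (≡.cong (λ j → adj Γ (v i α) (v j β)) (⊕-identityʳ i)) (edgeless κ cond i α β)
  blocks κ cond i 1F = block₁ κ cond i
  blocks κ cond i 2F = block₂ κ cond i
  blocks κ cond i 3F with block₂ κ cond (i ⊕ 3)
  ... | s , e = s , λ α β → ≡.trans
    (reversed (i ⊕ 3) β (≡.trans (⊕-assoc i 3F 2F) (⊕-identityʳ i)))
    (e β α)
  blocks κ cond i 4F with block₁ κ cond (i ⊕ 4)
  ... | s , e = s , λ α β → ≡.trans
    (reversed (i ⊕ 4) β (≡.trans (⊕-assoc i 4F 1F) (⊕-identityʳ i)))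
    (e β α)

  adjC-source : ∀ κ δ i α β → let k , l = source κ δ ; j = i ⊕ toℕ δ in
    adjC Γ P κ δ i α j β ≡ adj Γ (v (shift k i) α) (v (shift l j) β)
  adjC-source κ     0F i α β = ≡.refl
  adjC-source caseA 1F i α β = ≡.refl
  adjC-source caseB 1F i α β = ≡.cong (λ j → adj Γ (v (i ⊕ 1) α) (v j β)) (≡.sym (⊕-assoc i 1F 1F))
  adjC-source caseC 1F i α β = ≡.cong (λ j → adj Γ (v i α) (v j β)) (≡.sym (⊕-assoc i 1F 1F))
  adjC-source caseA 2F i α β = ≡.cong (λ j → adj Γ (v i α) (v j β)) (≡.sym (⊕-assoc i 2F 1F))
  adjC-source caseB 2F i α β = ≡.cong (λ j → adj Γ (v i α) (v j β)) (≡.sym (⊕-assoc i 2F 1F))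
  adjC-source caseC 2F i α β = ≡.refl
  adjC-source caseA 3F i α β = ≡.sym (reversed (i ⊕ 3) β (⊕-assoc i 3F 3F))
  adjC-source caseB 3F i α β = ≡.sym (reversed (i ⊕ 3) β (⊕-assoc i 3F 3F))
  adjC-source caseC 3F i α β =
    ≡.sym (reversed ((i ⊕ 3) ⊕ 1) β (≡.trans (⊕-assoc i 3F 2F) (⊕-identityʳ i)))
  adjC-source caseA 4F i α β =
    ≡.sym (reversed (i ⊕ 4) β (≡.trans (⊕-assoc i 4F 1F) (⊕-identityʳ i)))
  adjC-source caseB 4F i α β = ≡.sym (reversed ((i ⊕ 4) ⊕ 1) β (⊕-assoc i 4F 2F))
  adjC-source caseC 4F i α β = ≡.sym (reversed (i ⊕ 4) β (⊕-assoc i 4F 2F))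

  -- For a vertex vᵢα the column is E applied to the unit vector at α, placed on Cᵢ, plus F applied
  -- to it, placed on Cᵢ₊₁. The latter is ½ at α and -½ at the other vertex.
  weights : Maybe (ℤ₅ × Fin 2) → Fin n → Functional n
  weights nothing        u = (1ᴿ , u) ∷ []
  weights (just (i , α)) u =
    (fromℚ ½ , v i #1) ∷ (fromℚ ½ , v i #2) ∷
    (fromℚ ½ , v (i ⊕ 1) α) ∷ (fromℚ (ℚ.- ½) , v (i ⊕ 1) (opposite α)) ∷ []

  -- Q u is the column of Q at the vertex u.
  Q : Fin n → Functional n
  Q u = weights (class u) u

  indicator : (Fin n → Fin n → Bool) → Matrix n
  indicator E u w = fromℚ ⟦ E u w ⟧

  -- QᵀEQ = E′ for symmetric 0-1 matrices E and E′.
  record Switches (E E′ : Fin n → Fin n → Bool) : Set where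
    field
      sym₁   : ∀ u w → E u w ≡ E w u
      sym₂   : ∀ u w → E′ u w ≡ E′ w u
      on-DD  : ∀ u w → InD Γ P u → InD Γ P w → E u w ≡ E′ u w
      on-DC  : ∀ u → InD Γ P u → ∀ i α →
        mixed (λ ε → ⟦ E u (v i ε) ⟧) (λ ε → ⟦ E u (v (i ⊕ 1) ε) ⟧) α ≡ ⟦ E′ u (v i α) ⟧
      on-CC  : ∀ i j α β →
        mixed₂ (λ k l α β → E (v (shift k i) α) (v (shift l j) β)) α β ≡ ⟦ E′ (v i α) (v j β) ⟧

  -- The recursion is on the classes as arguments: a with-abstraction would
  -- normalise the Cauchy proofs inside the reals of the goal.
  conjugate-switches : ∀ {E E′} → Switches E E′ →
    ∀ u w → conjugate Q (indicator E) u w ≈ᴿ indicator E′ u w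
  conjugate-switches {E} {E′} sw u w = entry (class u) (class w) ≡.refl ≡.refl
    where
    open Switches sw
    entry : ∀ c d → class u ≡ c → class w ≡ d →
      ⟨ weights c u , (λ p → ⟨ weights d w , indicator E p ⟩) ⟩ ≈ᴿ indicator E′ u w
    -- At each index of the sequences an identity of rationals remains. `mixed` has the bracketing
    -- and the final `0ℚ` of `⟨_,_⟩`, so a column at some vᵢα unfolds to it definitionally; a column
    -- at a vertex of D leaves a factor 1 and a summand 0 for `unit-weight`.
    entry nothing nothing u∈ w∈ = ≗⇒≈ᴿ λ _ →
      ≡.trans (unit-weight _) (≡.trans (unit-weight _) (≡.cong ⟦_⟧ (on-DD u w u∈ w∈)))
    entry nothing (just (j , β)) u∈ w∈ = ≗⇒≈ᴿ λ _ →
      ≡.trans (unit-weight _) (≡.trans (on-DC u u∈ j β)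
        (≡.cong (λ w → ⟦ E′ u w ⟧) (≡.sym (class⁻¹ w∈))))
    entry (just (i , α)) nothing u∈ w∈ = ≗⇒≈ᴿ λ _ →
      ≡.trans (mixed-cong (λ ε → ≡.trans (unit-weight _) (≡.cong ⟦_⟧ (sym₁ (v i ε) w)))
                          (λ ε → ≡.trans (unit-weight _) (≡.cong ⟦_⟧ (sym₁ (v (i ⊕ 1) ε) w))) α)
        (≡.trans (on-DC w w∈ i α)
          (≡.cong ⟦_⟧ (≡.trans (sym₂ w (v i α)) (≡.cong (λ u → E′ u w) (≡.sym (class⁻¹ u∈))))))
    entry (just (i , α)) (just (j , β)) u∈ w∈ = ≗⇒≈ᴿ λ _ →
      ≡.trans (on-CC i j α β)
        (≡.cong₂ (λ u w → ⟦ E′ u w ⟧) (≡.sym (class⁻¹ u∈)) (≡.sym (class⁻¹ w∈)))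

  v-injective : ∀ {i j α β} → v i α ≡ v j β → (i , α) ≡ (j , β)
  v-injective {i} {j} {α} {β} eq = just-injective
    (≡.trans (≡.sym (class-v i α)) (≡.trans (≡.cong class eq) (class-v j β)))

  does-v : ∀ i α j β → does (v i α ≟ v j β) ≡ does (i ≟ j) ∧ same α β
  does-v i α j β = ≡-does (mk⇔ to from) ((i ≟ j) ×-dec (α ≟ β))
    where
    to : does (v i α ≟ v j β) ≡ true → i ≡ j × α ≡ β
    to eq with v i α ≟ v j β
    ... | yes e = ,-injective (v-injective e)
    from : i ≡ j × α ≡ β → does (v i α ≟ v j β) ≡ true
    from (≡.refl , ≡.refl) = dec-true (v i α ≟ v i α) ≡.refl

  D≢v : ∀ {u} → InD Γ P u → ∀ i α → does (u ≟ v i α) ≡ false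
  D≢v {u} u∈D i α = dec-false (u ≟ v i α) λ { ≡.refl → contradiction (≡.trans (≡.sym u∈D) (class-v i α)) λ () }

  identity-switches : Switches (λ u w → does (u ≟ w)) (λ u w → does (u ≟ w))
  identity-switches = record
    { sym₁  = swap
    ; sym₂  = swap
    ; on-DD = λ _ _ _ _ → ≡.refl
    ; on-DC = λ u u∈D i α → ≡.trans
        (mixed-cong (λ ε → ≡.cong ⟦_⟧ (D≢v u∈D i ε)) (λ ε → ≡.cong ⟦_⟧ (D≢v u∈D (i ⊕ 1) ε)) α)
        (≡.cong ⟦_⟧ (≡.sym (D≢v u∈D i α)))
    ; on-CC = λ i j α β → ≡.trans
        (mixed₂-cong (λ k l α β → does-v (shift k i) α (shift l j) β) α β)
        (≡.trans (mixed₂-same i j α β) (≡.cong ⟦_⟧ (≡.sym (does-v i α j β))))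
    }
    where
    swap : ∀ (u w : Fin n) → does (u ≟ w) ≡ does (w ≟ u)
    swap u w with u ≟ w
    ... | yes e = ≡.sym (dec-true (w ≟ u) (≡.sym e))
    ... | no ≢  = ≡.sym (dec-false (w ≟ u) (≢ ∘ ≡.sym))

  -- QᵀJQ = J, because the weights ½ + ½ + ½ - ½ of every column sum to 1. The entries are closed
  -- rational expressions that evaluate to this.
  constant-switches : Switches (λ _ _ → true) (λ _ _ → true)
  constant-switches = record
    { sym₁  = λ _ _ → ≡.refl
    ; sym₂  = λ _ _ → ≡.refl
    ; on-DD = λ _ _ _ _ → ≡.refl
    ; on-DC = λ _ _ _ _ → ≡.refl
    ; on-CC = λ _ _ _ _ → ≡.refl
    }

  module _ (κ : Case) (parity : ParityCondition Γ P) (cond : CaseCondition Γ P κ) where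

    private Γ′ = switched Γ P κ

    adjD-mixed : ∀ u → InD Γ P u → ∀ i α →
      mixed (λ ε → ⟦ adj Γ u (v i ε) ⟧) (λ ε → ⟦ adj Γ u (v (i ⊕ 1) ε) ⟧) α ≡ ⟦ adjD Γ P u i α ⟧
    adjD-mixed u u∈D i α = entry (oneInEach? Γ P u)
      where
      even : ¬ (∀ l → neighboursIn Γ P l u ≡ 1) → ∀ k → neighboursIn Γ P k u % 2 ≡ 0
      even ¬one k with count-parity (adj Γ u ∘ v k)
      ... | inj₂ eq  = eq
      -- One odd count makes all counts odd by `parity`, and the only odd number among 0, 1, 2 is 1.
      ... | inj₁ eq  = contradiction one ¬one
        where
        one : ∀ l → neighboursIn Γ P l u ≡ 1
        one l with count-parity (adj Γ u ∘ v l)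
        ... | inj₁ eq′ = eq′
        ... | inj₂ eq′ = contradiction
          (≡.trans (≡.sym (≡.cong (_% 2) eq)) (≡.trans (parity u u∈D k l) eq′)) λ ()
      entry : (one? : Dec (∀ l → neighboursIn Γ P l u ≡ 1)) →
        mixed (λ ε → ⟦ adj Γ u (v i ε) ⟧) (λ ε → ⟦ adj Γ u (v (i ⊕ 1) ε) ⟧) α ≡
        ⟦ if does one? then adj Γ u (v (i ⊕ 1) α) else adj Γ u (v i α) ⟧
      entry (yes one) = mixed-one (adj Γ u ∘ v i) (adj Γ u ∘ v (i ⊕ 1)) (one i) (one (i ⊕ 1)) α
      entry (no ¬one) =
        mixed-even (adj Γ u ∘ v i) (adj Γ u ∘ v (i ⊕ 1)) (even ¬one i) (even ¬one (i ⊕ 1)) α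

    adjC-mixed : ∀ i j α β →
      mixed₂ (λ k l α β → adj Γ (v (shift k i) α) (v (shift l j) β)) α β ≡
      ⟦ adjC Γ P κ (j ⊖ i) i α j β ⟧
    adjC-mixed i j α β = ≡.trans (mixed₂-cong shape-at α β)
      (≡.trans (mixed₂-shape κ δ (s #1 #1) (s #1 #2) (s #2 #1) (s #2 #2) α β)
        (≡.cong ⟦_⟧ (≡.trans (≡.sym (shape-at k₀ l₀ α β)) (≡.sym source-at))))
      where
      δ = j ⊖ i
      k₀ = proj₁ (source κ δ)
      l₀ = proj₂ (source κ δ)
      s : Fin 2 → Fin 2 → Fin 2
      s k l = proj₁ (blocks κ cond (shift k i) (offset k l δ))
      -- The choice function is tabulated by its four values, since the finite check quantifies over
      -- four elements of `Fin 2` and not over functions.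
      s′ = select (s #1 #1) (s #1 #2) (s #2 #1) (s #2 #2)
      select-s : ∀ k l → s k l ≡ s′ k l
      select-s #1 #1 = ≡.refl
      select-s #1 #2 = ≡.refl
      select-s #2 #1 = ≡.refl
      select-s #2 #2 = ≡.refl
      shape-at : ∀ k l α β →
        adj Γ (v (shift k i) α) (v (shift l j) β) ≡ shape κ (offset k l δ) (s′ k l) α β
      shape-at k l α β = ≡.trans
        (≡.cong (λ j → adj Γ (v (shift k i) α) (v j β)) (≡.sym (offset-shift k l i j)))
        (≡.trans (proj₂ (blocks κ cond (shift k i) (offset k l δ)) α β)
          (≡.cong (λ s → shape κ (offset k l δ) s α β) (select-s k l)))
      source-at : adjC Γ P κ δ i α j β ≡ adj Γ (v (shift k₀ i) α) (v (shift l₀ j) β)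
      -- `adjC-source` has its second index in the form `i ⊕ toℕ δ`, which permits matching on `δ`;
      -- the given `j` is reached by transport.
      source-at = ≡.subst
        (λ j′ → adjC Γ P κ δ i α j′ β ≡ adj Γ (v (shift k₀ i) α) (v (shift l₀ j′) β))
        (⊖-⊕ i j) (adjC-source κ δ i α β)

    adjacency-switches : Switches (adj Γ) (adj Γ′)
    adjacency-switches = record
      { sym₁  = symmetric Γ
      ; sym₂  = symmetric Γ′
      ; on-DD = DD
      ; on-DC = λ u u∈D i α → ≡.trans (adjD-mixed u u∈D i α) (≡.cong ⟦_⟧ (≡.sym (DC u u∈D i α)))
      ; on-CC = λ i j α β → ≡.trans (adjC-mixed i j α β) (≡.cong ⟦_⟧ (≡.sym (CC i j α β)))
      }
      where
      DD : ∀ u w → InD Γ P u → InD Γ P w → adj Γ u w ≡ adj Γ′ u w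
      DD u w u∈D w∈D rewrite u∈D | w∈D = ≡.refl
      DC : ∀ u → InD Γ P u → ∀ i α → adj Γ′ u (v i α) ≡ adjD Γ P u i α
      DC u u∈D i α rewrite u∈D | class-v i α = ≡.refl
      CC : ∀ i j α β → adj Γ′ (v i α) (v j β) ≡ adjC Γ P κ (j ⊖ i) i α j β
      CC i j α β rewrite class-v i α | class-v j β = ≡.refl

    open CommutativeRing ℝ-commutativeRing using (_≈_; refl; sym; trans; +-congʳ)

    indicator-if : ∀ b → (if b then 1ᴿ else 0ᴿ) ≈ fromℚ ⟦ b ⟧
    indicator-if true  = refl
    indicator-if false = refl

    conjugate-identity : ∀ u w → conjugate Q (scalar 1ᴿ) u w ≈ scalar 1ᴿ u w
    conjugate-identity u w = trans
      (conjugate-cong Q (λ i j → indicator-if (does (i ≟ j))) u w)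
      (trans (conjugate-switches identity-switches u w) (sym (indicator-if (does (u ≟ w)))))

    conjugate-adjacency : ∀ r u w → conjugate Q (A[ Γ ]+ r J) u w ≈ (A[ Γ′ ]+ r J) u w
    conjugate-adjacency r = conjugate-translate Q (conjugate-switches constant-switches)
      (λ u w → trans (conjugate-cong Q (λ i j → indicator-if (adj Γ i j)) u w)
        (trans (conjugate-switches adjacency-switches u w) (sym (indicator-if (adj Γ′ u w))))) r

    charpoly-switched : ∀ r x → charpoly (A[ Γ′ ]+ r J) x ≈ charpoly (A[ Γ ]+ r J) x
    charpoly-switched r = charpoly-conjugate Q conjugate-identity (conjugate-adjacency r)

corollary9 : ∀ (n : ℕ) (Γ : Graph n) (P : Partition n) (κ : Case) →
    ParityCondition Γ P → CaseCondition Γ P κ →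
    ℝ-Cospectral Γ (switched Γ P κ)
corollary9 n Γ P κ parity cond r λs = mk⇔
  (λ spectrum x → trans (same-charpoly x) (spectrum x))
  (λ spectrum x → trans (sym (same-charpoly x)) (spectrum x))
  where
  open CommutativeRing ℝ-commutativeRing using (trans; sym)
  same-charpoly = charpoly-switched Γ P κ parity cond r
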